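{- ${\sf ITL}^0_{\Diamond\forall}$ is complete for $\mathbb Q$: every $\varphi\in\mathcal L_{\Diamond\forall}$ valid on all dynamical systems $(\mathbb Q,f)$ ($\mathbb Q$ with its usual topology, $f$ continuous) is derivable in ${\sf ITL}^0_{\Diamond\forall}$.
   Context: Fix a countably infinite set $\mathbb P$ of propositional variables. $\mathcal L_{\Diamond\forall}$ is given by $\varphi::=\bot\mid p\mid \varphi\wedge\varphi\mid\varphi\vee\varphi\mid\varphi\to\varphi\mid{\circ}\varphi\mid\Diamond\varphi\mid\forall\varphi$; $\neg\varphi:=\varphi\to\bot$. For a topological space $X$ and continuous $f:X\to X$, a valuation assigns open sets to formulas with $[\![\bot]\!]=\varnothing$, $[\![p]\!]$ any open set, $\wedge,\vee$ as intersection/union, $[\![\varphi\to\psi]\!]$ = interior of $(X\setminus[\![\varphi]\!])\cup[\![\psi]\!]$, $[\![{\circ}\varphi]\!]=f^{ -1}[\![\varphi]\!]$, $[\![\Diamond\varphi]\!]=\bigcup_{n<\omega}f^{ -n}[\![\varphi]\!]$, $[\![\forall\varphi]\!]=X$ if $[\![\varphi]\!]=X$ and $\varnothing$ otherwise; $\varphi$ is valid on $(X,f)$ if $[\![\varphi]\!]=X$ for all valuations. ${\sf ITL}^0_{\Diamond\forall}$ is the least set of $\mathcal L_{\Diamond\forall}$-formulas containing all substitution instances of the axioms of intuitionistic propositional logic and of: $\neg{\circ}\bot$; ${\circ}\varphi\wedge{\circ}\psi\to{\circ}(\varphi\wedge\psi)$; ${\circ}(\varphi\vee\psi)\to{\circ}\varphi\vee{\circ}\psi$;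 ${\circ}(\varphi\to\psi)\to({\circ}\varphi\to{\circ}\psi)$; $\varphi\vee{\circ}\Diamond\varphi\to\Diamond\varphi$; $\forall\varphi\vee\neg\forall\varphi$; $\forall(\varphi\to\psi)\to(\forall\varphi\to\forall\psi)$; $\forall(\varphi\vee\forall\psi)\to\forall\varphi\vee\forall\psi$; $\forall\varphi\to\varphi$; $\forall\varphi\to\forall\forall\varphi$; $\forall\varphi\leftrightarrow{\circ}\forall\varphi$; and closed under modus ponens, from $\varphi$ infer ${\circ}\varphi$, from $\varphi\to\psi$ infer $\Diamond\varphi\to\Diamond\psi$, from ${\circ}\varphi\to\varphi$ infer $\Diamond\varphi\to\varphi$, and from $\varphi$ infer $\forall\varphi$. -}

module Defs where

open import Data.Nat using (ℕ; zero; suc)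
open import Data.Rational using (ℚ; 0ℚ; _<_; _-_; ∣_∣)
open import Data.Product using (Σ; _×_)
open import Data.Empty using (⊥)

infixr 5 _⇒_
infixr 6 _∨′_
infixr 7 _∧′_
data Formula : Set where
  ⊥′   : Formula
  var  : ℕ → Formula
  _∧′_ : Formula → Formula → Formula
  _∨′_ : Formula → Formula → Formula
  _⇒_  : Formula → Formula → Formula
  ○    : Formula → Formula
  ◇    : Formula → Formula
  A    : Formula → Formula

¬′ : Formula → Formula
¬′ φ = φ ⇒ ⊥′

_⇔_ : Formula → Formula → Formula
φ ⇔ ψ = (φ ⇒ ψ) ∧′ (ψ ⇒ φ)

infix 3 ⊢_
data ⊢_ : Formula → Set where
  k    : ∀ {φ ψ} → ⊢ φ ⇒ (ψ ⇒ φ)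
  s    : ∀ {φ ψ χ} → ⊢ (φ ⇒ (ψ ⇒ χ)) ⇒ ((φ ⇒ ψ) ⇒ (φ ⇒ χ))
  ∧e₁  : ∀ {φ ψ} → ⊢ φ ∧′ ψ ⇒ φ
  ∧e₂  : ∀ {φ ψ} → ⊢ φ ∧′ ψ ⇒ ψ
  ∧i   : ∀ {φ ψ} → ⊢ φ ⇒ (ψ ⇒ φ ∧′ ψ)
  ∨i₁  : ∀ {φ ψ} → ⊢ φ ⇒ φ ∨′ ψ
  ∨i₂  : ∀ {φ ψ} → ⊢ ψ ⇒ φ ∨′ ψ
  ∨e   : ∀ {φ ψ χ} → ⊢ (φ ⇒ χ) ⇒ ((ψ ⇒ χ) ⇒ (φ ∨′ ψ ⇒ χ))
  efq  : ∀ {φ} → ⊢ ⊥′ ⇒ φ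
  ○⊥     : ⊢ ¬′ (○ ⊥′)
  ○∧     : ∀ {φ ψ} → ⊢ ○ φ ∧′ ○ ψ ⇒ ○ (φ ∧′ ψ)
  ○∨     : ∀ {φ ψ} → ⊢ ○ (φ ∨′ ψ) ⇒ ○ φ ∨′ ○ ψ
  ○⇒     : ∀ {φ ψ} → ⊢ ○ (φ ⇒ ψ) ⇒ (○ φ ⇒ ○ ψ)
  ◇fix   : ∀ {φ} → ⊢ φ ∨′ ○ (◇ φ) ⇒ ◇ φ
  Aem    : ∀ {φ} → ⊢ A φ ∨′ ¬′ (A φ)
  AK     : ∀ {φ ψ} → ⊢ A (φ ⇒ ψ) ⇒ (A φ ⇒ A ψ)
  A∨     : ∀ {φ ψ} → ⊢ A (φ ∨′ A ψ) ⇒ A φ ∨′ A ψ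
  AT     : ∀ {φ} → ⊢ A φ ⇒ φ
  A4     : ∀ {φ} → ⊢ A φ ⇒ A (A φ)
  A○     : ∀ {φ} → ⊢ A φ ⇔ ○ (A φ)
  mp     : ∀ {φ ψ} → ⊢ φ ⇒ ψ → ⊢ φ → ⊢ ψ
  ○nec   : ∀ {φ} → ⊢ φ → ⊢ ○ φ
  ◇mono  : ∀ {φ ψ} → ⊢ φ ⇒ ψ → ⊢ ◇ φ ⇒ ◇ ψ
  ◇ind   : ∀ {φ} → ⊢ ○ φ ⇒ φ → ⊢ ◇ φ ⇒ φ
  Anec   : ∀ {φ} → ⊢ φ → ⊢ A φ

Pred : Set₁
Pred = ℚ → Set

Interior : Pred → Pred
Interior S x = Σ ℚ (λ ε → (0ℚ < ε) × (∀ y → ∣ y - x ∣ < ε → S y))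

IsOpen : Pred → Set
IsOpen S = ∀ x → S x → Interior S x

Continuous : (ℚ → ℚ) → Set
Continuous f = ∀ x ε → 0ℚ < ε →
  Σ ℚ (λ δ → (0ℚ < δ) × (∀ y → ∣ y - x ∣ < δ → ∣ f y - f x ∣ < ε))

iter : (ℚ → ℚ) → ℕ → ℚ → ℚ
iter f zero    x = x
iter f (suc n) x = f (iter f n x)

⟦_⟧ : Formula → (ℚ → ℚ) → (ℕ → Pred) → Pred
⟦ ⊥′ ⟧     f V x = ⊥
⟦ var p ⟧  f V x = V p x
⟦ φ ∧′ ψ ⟧ f V x = ⟦ φ ⟧ f V x × ⟦ ψ ⟧ f V x
⟦ φ ∨′ ψ ⟧ f V x = Data.Sum._⊎_ (⟦ φ ⟧ f V x) (⟦ ψ ⟧ f V x)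
  where import Data.Sum
⟦ φ ⇒ ψ ⟧  f V x = Interior (λ y → ⟦ φ ⟧ f V y → ⟦ ψ ⟧ f V y) x
⟦ ○ φ ⟧    f V x = ⟦ φ ⟧ f V (f x)
⟦ ◇ φ ⟧    f V x = Σ ℕ (λ n → ⟦ φ ⟧ f V (iter f n x))
⟦ A φ ⟧    f V x = ∀ y → ⟦ φ ⟧ f V y

ValidOn : (ℚ → ℚ) → Formula → Set₁
ValidOn f φ = (V : ℕ → Pred) → (∀ p → IsOpen (V p)) → ∀ x → ⟦ φ ⟧ f V x

ValidOnℚ : Formula → Set₁
ValidOnℚ φ = (f : ℚ → ℚ) → Continuous f → ValidOn f φ

{-# OPTIONS --safe #-}

-- Fix a finite set F of formulas closed under subformulas and a guess which formulas A ψ of F are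
-- true.  A moment is a finite tree of subsets of F, strictly growing from a node to its children:
-- it records which subsets occur as theories above a point.  There are finitely many moments, and
-- each moment w has a formula excl w that expresses that w is not realised above the current point.
-- If all successors of w are excluded at the next point, then w is excluded now; so moments without
-- successors, and by ◇-induction moments with an unfulfillable ◇ψ, can be deleted one after the
-- other, and every deleted moment is provably excluded.  If φ belongs to all surviving moments, it
-- is provable.  Otherwise the survivors are the states of a transition system whose paths yield a
-- countermodel: up to coding, its points are eventually constant sequences of growing states, and
-- its map drops the first entry of a sequence and moves every other entry to a successor.  Such
-- sequences are coded by lists of natural numbers, and ℚ is homeomorphic to the space of lists in
-- which the extensions of l whose first new entry is large are the points close to l.
module Submission where

open import Data.Bool as Bool using (Bool; true; false; _∧_; _∨_; not; if_then_else_)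
open import Data.Bool.Properties using (not-injective; ∨-zeroʳ)
open import Data.Empty using (⊥; ⊥-elim)
open import Data.Fin as Fin using (Fin; zero; suc; toℕ; fromℕ; inject₁; combine; remQuot)
import Data.Fin.Properties as Finₚ
open import Data.List as List using (List; []; _∷_; _++_; map; filter; length; lookup; concatMap; cartesianProductWith)
open import Data.Nat as ℕ using (ℕ; zero; suc)
open import Data.Nat.GeneralisedArithmetic using (fold)
import Data.Nat.Properties as ℕₚ
open import Data.Product using (∃; _×_; _,_; proj₁; proj₂)
open import Data.Rational as ℚ using (ℚ)
open import Data.Sum as Sum using (_⊎_; inj₁; inj₂; [_,_])
open import Data.Unit using (⊤; tt)
open import Function using (_∘_; id)
open import Relation.Binary.PropositionalEquality hiding ([_])
open import Relation.Nullary using (¬_; Dec; yes; no; does; contradiction)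
open import Relation.Nullary.Decidable using (dec-true; dec-false; from-yes; ¬?; _×-dec_; _⊎-dec_)

-- Truth of `◇ ψ` is not compact, so a canonical model made of infinite theories could leave an
-- eventuality unfulfilled. With finitely many moments, those at which `◇ ψ` is unfulfillable form a
-- finite set, and the conjunction of their exclusions is a formula to which `◇ind` applies.
-- Intuitionistically a formula missing from a theory need not be refutable. Instead it implies a
-- fixed goal `C`, and case distinctions are cuts on `θ` against `θ ⇒ C`. The successor relation is
-- many-valued whereas `f` is a function. Points therefore carry whole upward paths, and truth is
-- read at the last state: a very late extra move is a small change of the point, and forward
-- confluence lets the image path follow each move. Since every script ends, fulfilment of
-- eventualities comes down to the orbit of one state under a chosen continuation. All alternatives
-- are decided over finite lists, and validity only serves to reject a survivor that omits `φ`, so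
-- the argument is constructive.

does-true : ∀ {P : Set} (d : Dec P) → does d ≡ true → P
does-true (yes p) _ = p

does-cong : ∀ {P Q : Set} (p : Dec P) (q : Dec Q) → (P → Q) → (Q → P) → does p ≡ does q
does-cong p (yes y) f g = dec-true p (g y)
does-cong p (no ¬y) f g = dec-false p (¬y ∘ f)

∧-split : ∀ {a b} → a ∧ b ≡ true → a ≡ true × b ≡ true
∧-split {true} {true} _ = refl , refl

fold-shift : ∀ {X : Set} (f : X → X) x n → fold (f x) f n ≡ fold x f (suc n)
fold-shift f x zero    = refl
fold-shift f x (suc n) = cong f (fold-shift f x n)

least : (P : ℕ → Bool) → ∀ n → P n ≡ true → ∃ λ m → P m ≡ true × m ℕ.≤ n × (∀ {k} → k ℕ.< m → P k ≡ false)
least P zero    Pn = 0 , Pn , ℕ.z≤n , λ ()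
least P (suc n) Pn with P 0 in eq
... | true = 0 , eq , ℕ.z≤n , λ ()
... | false with least (P ∘ suc) n Pn
... | m , Pm , m≤n , below = suc m , Pm , ℕ.s≤s m≤n , λ { {zero} _ → eq ; {suc k} (ℕ.s≤s k<m) → below k<m }

-- Near gap n l is the n-th basic neighbourhood of l: extensions a ∷ r of [] converge to [] as gap a → ∞.
data Near {X : Set} (gap : X → ℕ) (n : ℕ) : List X → List X → Set where
  stay  : ∀ {l} → Near gap n l l
  leave : ∀ {a l} → n ℕ.≤ gap a → Near gap n [] (a ∷ l)
  keep  : ∀ {a l l′} → Near gap n l l′ → Near gap n (a ∷ l) (a ∷ l′)

-- The homeomorphism between ℚ and lists of natural numbers

module Rationals where

  open import Data.Integer as ℤ using (ℤ; +_; -[1+_])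
  import Data.Integer.Properties as ℤₚ
  import Data.Integer.Solver
  import Data.Nat.Divisibility as ℕ∣
  open import Data.Nat.Primality using (prime?; euclidsLemma)
  import Data.Nat.Solver
  open import Data.Rational
    using (mkℚ; 0ℚ; 1ℚ; ½; _<_; _≤_; _+_; _*_; _-_; -_; ∣_∣; 1/_; _/_; _⊓_; ↥_; toℚᵘ; positive; nonNegative)
  open import Data.Rational.Properties
  open import Data.Rational.Solver using (module +-*-Solver)
  import Data.Rational.Unnormalised as ℚᵘ
  import Data.Rational.Unnormalised.Properties as ℚᵘₚ
  open import Relation.Binary.Definitions using (tri<; tri≈; tri>)

  Within : ℚ → ℚ → (ℚ → Set) → Set
  Within x ε P = ∀ y → ∣ y - x ∣ < ε → P y

  Nearby : ℚ → (ℚ → Set) → Set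
  Nearby x P = ∃ λ ε → 0ℚ < ε × Within x ε P

  -- Irrationality of √2

  even-sq : ∀ a → 2 ℕ∣.∣ a ℕ.* a → 2 ℕ∣.∣ a
  even-sq a d with euclidsLemma a a (from-yes (prime? 2)) d
  ... | inj₁ e = e
  ... | inj₂ e = e

  -- Infinite descent with `n` as fuel: `a` is even, say `a = 2c`, and then `b` and `c` solve the
  -- same equation with `c < b`.
  √2-irrational : ∀ n a b → b ℕ.≤ n → a ℕ.* a ≡ 2 ℕ.* (b ℕ.* b) → b ≡ 0
  √2-irrational n a zero le eq = refl
  √2-irrational (suc n) a (suc b) le eq
    with even-sq a (ℕ∣.divides (suc b ℕ.* suc b) (trans eq (ℕₚ.*-comm 2 (suc b ℕ.* suc b))))
  ... | ℕ∣.divides c refl = contradiction (subst (λ c → suc b ℕ.* suc b ≡ 2 ℕ.* (c ℕ.* c)) c≡0 eq′) λ ()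
    where
    open Data.Nat.Solver.+-*-Solver
    eq′ : suc b ℕ.* suc b ≡ 2 ℕ.* (c ℕ.* c)
    eq′ = ℕₚ.*-cancelˡ-≡ _ _ 2 (trans (sym eq)
            (solve 1 (λ c → c :* con 2 :* (c :* con 2) := con 2 :* (con 2 :* (c :* c))) refl c))
    c<b : c ℕ.< suc b
    c<b with c ℕ.<? suc b
    ... | yes p = p
    ... | no ¬p = contradiction eq′ (ℕₚ.<⇒≢ (ℕₚ.<-≤-trans
          (ℕₚ.m<m+n (suc b ℕ.* suc b) (ℕ.s≤s ℕ.z≤n)) (ℕₚ.+-mono-≤ (ℕₚ.*-mono-≤ (ℕₚ.≮⇒≥ ¬p) (ℕₚ.≮⇒≥ ¬p))
            (ℕₚ.≤-trans (ℕₚ.*-mono-≤ (ℕₚ.≮⇒≥ ¬p) (ℕₚ.≮⇒≥ ¬p)) (ℕₚ.≤-reflexive (sym (ℕₚ.+-identityʳ _)))))))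
    c≡0 : c ≡ 0
    c≡0 = √2-irrational n (suc b) c (ℕₚ.≤-pred (ℕₚ.≤-trans c<b le)) eq′

  ∣-∣-double-sq : ∀ i j → i ℤ.* i ≡ + 2 ℤ.* (j ℤ.* j) → ℤ.∣ i ∣ ℕ.* ℤ.∣ i ∣ ≡ 2 ℕ.* (ℤ.∣ j ∣ ℕ.* ℤ.∣ j ∣)
  ∣-∣-double-sq i j eq = begin
    ℤ.∣ i ∣ ℕ.* ℤ.∣ i ∣         ≡⟨ ℤₚ.abs-* i i ⟨
    ℤ.∣ i ℤ.* i ∣               ≡⟨ cong ℤ.∣_∣ eq ⟩
    ℤ.∣ + 2 ℤ.* (j ℤ.* j) ∣     ≡⟨ ℤₚ.abs-* (+ 2) (j ℤ.* j) ⟩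
    2 ℕ.* ℤ.∣ j ℤ.* j ∣         ≡⟨ cong (2 ℕ.*_) (ℤₚ.abs-* j j) ⟩
    2 ℕ.* (ℤ.∣ j ∣ ℕ.* ℤ.∣ j ∣) ∎
    where open ≡-Reasoning

  sq : ℚ → ℚ
  sq d = d * d

  √2-irrationalℚ : ∀ d r → sq d + sq d ≡ sq r → d ≡ 0ℚ
  √2-irrationalℚ d@(mkℚ n m _) r@(mkℚ p q _) eq = ↥p≡0⇒p≡0 d (ℤₚ.∣i∣≡0⇒i≡0 n≡0)
    where
    D = ℤ.+ suc m
    E = ℤ.+ suc q
    open ℚᵘ using (_≃_; *≡*)
    eqᵘ : (toℚᵘ d ℚᵘ.* toℚᵘ d) ℚᵘ.+ (toℚᵘ d ℚᵘ.* toℚᵘ d) ≃ toℚᵘ r ℚᵘ.* toℚᵘ r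
    eqᵘ = ℚᵘₚ.≃-trans (ℚᵘₚ.≃-sym (ℚᵘₚ.≃-trans (toℚᵘ-homo-+ (sq d) (sq d)) (ℚᵘₚ.+-cong (toℚᵘ-homo-* d d) (toℚᵘ-homo-* d d))))
                      (ℚᵘₚ.≃-trans (toℚᵘ-cong eq) (toℚᵘ-homo-* r r))
    eqℤ : (n ℤ.* n ℤ.* (D ℤ.* D) ℤ.+ n ℤ.* n ℤ.* (D ℤ.* D)) ℤ.* (E ℤ.* E) ≡ p ℤ.* p ℤ.* (D ℤ.* D ℤ.* (D ℤ.* D))
    eqℤ = ℚᵘₚ.drop-*≡* eqᵘ
    -- The factors coming from the denominators pair up, so this is again a square against twice a
    -- square.
    eqℤ′ : (p ℤ.* (D ℤ.* D)) ℤ.* (p ℤ.* (D ℤ.* D)) ≡ + 2 ℤ.* ((n ℤ.* D ℤ.* E) ℤ.* (n ℤ.* D ℤ.* E))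
    eqℤ′ = trans (solve 2 (λ p D → p :* (D :* D) :* (p :* (D :* D)) := p :* p :* (D :* D :* (D :* D))) refl p D)
           (trans (sym eqℤ)
           (solve 3 (λ n D E → (n :* n :* (D :* D) :+ n :* n :* (D :* D)) :* (E :* E) := con (+ 2) :*
                   ((n :* D :* E) :* (n :* D :* E))) refl n D E))
      where open Data.Integer.Solver.+-*-Solver
    nDE≡0 : ℤ.∣ n ∣ ℕ.* suc m ℕ.* suc q ≡ 0
    nDE≡0 = trans (sym (trans (ℤₚ.abs-* (n ℤ.* D) E) (cong (ℕ._* suc q) (ℤₚ.abs-* n D))))
                  (√2-irrational _ ℤ.∣ p ℤ.* (D ℤ.* D) ∣ _ ℕₚ.≤-refl (∣-∣-double-sq (p ℤ.* (D ℤ.* D)) (n ℤ.* D ℤ.* E) eqℤ′))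
    n≡0 : ℤ.∣ n ∣ ≡ 0
    n≡0 = ℕₚ.m*n≡0⇒m≡0 _ (suc m) (ℕₚ.m*n≡0⇒m≡0 _ (suc q) nDE≡0)

  -- Order and absolute value on ℚ

  p≤∣p∣ : ∀ p → p ≤ ∣ p ∣
  p≤∣p∣ p with ≤-total 0ℚ p
  ... | inj₁ 0≤p = ≤-reflexive (sym (0≤p⇒∣p∣≡p 0≤p))
  ... | inj₂ p≤0 = ≤-trans p≤0 (0≤∣p∣ p)

  ∣p-q∣-sym : ∀ p q → ∣ p - q ∣ ≡ ∣ q - p ∣
  ∣p-q∣-sym p q = trans (cong ∣_∣ (solve 2 (λ p q → p :- q := :- (q :- p)) refl p q)) (∣-p∣≡∣p∣ (q - p))
    where open +-*-Solver

  <⇒0<- : ∀ {p q} → p < q → 0ℚ < q - p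
  <⇒0<- {p} {q} lt = subst (_< q - p) (+-inverseʳ p) (+-monoˡ-< (- p) lt)

  -‿cancelʳ-< : ∀ p q r → p - r < q - r → p < q
  -‿cancelʳ-< p q r lt = subst₂ _<_ (lem p) (lem q) (+-monoˡ-< r lt)
    where
    open +-*-Solver
    lem : ∀ p → p - r + r ≡ p
    lem p = solve 2 (λ p r → p :- r :+ r := p) refl p r

  -‿cancelˡ-< : ∀ p q r → r - p < r - q → q < p
  -‿cancelˡ-< p q r lt = subst₂ _<_ (solve 3 (λ p q r → r :- p :+ (p :+ q :- r) := q) refl p q r)
    (solve 3 (λ p q r → r :- q :+ (p :+ q :- r) := p) refl p q r) (+-monoˡ-< (p + q - r) lt)
    where open +-*-Solver

  0<+ : ∀ {p q} → 0ℚ < p → 0ℚ < q → 0ℚ < p + q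
  0<+ = +-mono-<

  0<* : ∀ {p q} → 0ℚ < p → 0ℚ < q → 0ℚ < p * q
  0<* {p} {q} 0<p 0<q = positive⁻¹ (p * q) {{pos*pos⇒pos p {{positive 0<p}} q {{positive 0<q}}}}

  sq-abs : ∀ p → sq ∣ p ∣ ≡ sq p
  sq-abs p with ∣p∣≡p∨∣p∣≡-p p
  ... | inj₁ e = cong sq e
  ... | inj₂ e = trans (cong sq e) (solve 1 (λ p → :- p :* :- p := p :* p) refl p)
    where open +-*-Solver

  sq-mono-≤ : ∀ {p q} → 0ℚ ≤ p → p ≤ q → sq p ≤ sq q
  sq-mono-≤ {p} {q} 0≤p p≤q = ≤-trans (*-monoˡ-≤-nonNeg p {{nonNegative 0≤p}} p≤q)
          (*-monoʳ-≤-nonNeg q {{nonNegative (≤-trans 0≤p p≤q)}} p≤q)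

  0≤sq : ∀ p → 0ℚ ≤ sq p
  0≤sq p = subst (0ℚ ≤_) (sq-abs p) (sq-mono-≤ ≤-refl (0≤∣p∣ p))

  -- Continuity of doubled squares

  double : ℚ → ℚ
  double p = p + p

  -- Only `x - y` and `y` occur on the right, so near a fixed `y` a bound on `x - y` controls the
  -- whole difference.
  double-sq-diff : ∀ x y → double (sq x) - double (sq y) ≡ (x - y) * double ((x - y) + (y + y))
  double-sq-diff = solve 2 (λ x y → (x :* x :+ x :* x) :- (y :* y :+ y :* y)
                      := (x :- y) :* (((x :- y) :+ (y :+ y)) :+ ((x :- y) :+ (y :+ y)))) refl
    where open +-*-Solver

  1/-pos : ∀ {K} → 0ℚ < K → ∃ λ r → 0ℚ < r × r * K ≡ 1ℚ
  1/-pos {K} 0<K = (1/ K) {{pos⇒nonZero K {{positive 0<K}}}} , positive⁻¹ _ {{1/pos⇒pos K {{positive 0<K}}}} ,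
                   *-inverseˡ K {{pos⇒nonZero K {{positive 0<K}}}}

  -- `ε = η / (L + η)` meets both bounds at once, since `η` and `L` are both below `L + η`.
  small : ∀ {L η} → 0ℚ < L → 0ℚ < η → ∃ λ ε → 0ℚ < ε × ε < 1ℚ × ε * L < η
  small {L} {η} 0<L 0<η with 1/-pos (0<+ 0<L 0<η)
  ... | r , 0<r , rK = η * r , 0<ε , ε<1 , εL<η
    where
    0<ε : 0ℚ < η * r
    0<ε = 0<* 0<η 0<r
    εK : η * r * (L + η) ≡ η
    εK = trans (*-assoc η r (L + η)) (trans (cong (η *_) rK) (*-identityʳ η))
    η<K : η < L + η
    η<K = subst (_< L + η) (+-identityˡ η) (+-monoˡ-< η 0<L)
    ε<1 : η * r < 1ℚ
    ε<1 = *-cancelʳ-<-nonNeg (L + η) {{nonNegative (<⇒≤ (0<+ 0<L 0<η))}} (subst₂ _<_ (sym εK) (sym (*-identityˡ (L + η))) η<K)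
    εL<η : η * r * L < η
    εL<η = subst (η * r * L <_) εK (*-monoʳ-<-pos (η * r) {{positive 0<ε}} (subst (_< L + η) (+-identityʳ L) (+-monoʳ-< L 0<η)))

  ∣*double∣-≤ : ∀ h p {b} → ∣ p ∣ ≤ b → ∣ h * double p ∣ ≤ ∣ h ∣ * double b
  ∣*double∣-≤ h p {b} le = ≤-trans (≤-reflexive (∣p*q∣≡∣p∣*∣q∣ h (double p)))
    (*-monoˡ-≤-nonNeg ∣ h ∣ {{∣-∣-nonNeg h}} (≤-trans (∣p+q∣≤∣p∣+∣q∣ p p) (+-mono-≤ le le)))

  0<1 : 0ℚ < 1ℚ
  0<1 = positive⁻¹ 1ℚ

  0<1+ : ∀ {a} → 0ℚ ≤ a → 0ℚ < 1ℚ + a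
  0<1+ {a} 0≤a = <-≤-trans 0<1 (subst (_≤ 1ℚ + a) (+-identityʳ 1ℚ) (+-monoʳ-≤ 1ℚ 0≤a))

  double-sq-near : ∀ d d′ {η a ε} → 0ℚ ≤ a → ∣ d + d ∣ ≤ a → ε < 1ℚ → ε * double (1ℚ + a) < η → ∣ d′ - d ∣ < ε →
                   ∣ double (sq d′) - double (sq d) ∣ < η
  double-sq-near d d′ {η} {a} {ε} 0≤a le ε<1 εL<η lt = begin-strict
    ∣ double (sq d′) - double (sq d) ∣            ≡⟨ cong ∣_∣ (double-sq-diff d′ d) ⟩
    ∣ (d′ - d) * double ((d′ - d) + (d + d)) ∣    ≤⟨ ∣*double∣-≤ (d′ - d) ((d′ - d) + (d + d)) le′ ⟩
    ∣ d′ - d ∣ * double (1ℚ + a)                  ≤⟨ *-monoʳ-≤-nonNeg (double (1ℚ + a)) {{nonNegative 0≤L}} (<⇒≤ lt) ⟩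
    ε * double (1ℚ + a)                           <⟨ εL<η ⟩
    η                                             ∎
    where
    open ≤-Reasoning
    0≤L : 0ℚ ≤ double (1ℚ + a)
    0≤L = <⇒≤ (0<+ (0<1+ 0≤a) (0<1+ 0≤a))
    le′ : ∣ (d′ - d) + (d + d) ∣ ≤ 1ℚ + a
    le′ = ≤-trans (∣p+q∣≤∣p∣+∣q∣ (d′ - d) (d + d)) (+-mono-≤ (<⇒≤ (<-trans lt ε<1)) le)

  double-sq-continuous : ∀ d η → 0ℚ < η →
    ∃ λ ε → 0ℚ < ε × (∀ d′ → ∣ d′ - d ∣ < ε → ∣ double (sq d′) - double (sq d) ∣ < η)
  double-sq-continuous d η 0<η =
    let 0≤a = 0≤∣p∣ (d + d)
        ε , 0<ε , ε<1 , εL<η = small (0<+ (0<1+ 0≤a) (0<1+ 0≤a)) 0<η in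
    ε , 0<ε , λ d′ lt → double-sq-near d d′ {a = ∣ d + d ∣} 0≤a ≤-refl ε<1 εL<η lt

  -- inBall c r x tests ∣ x - c ∣ < r / √2.  As r / √2 is irrational, the test is locally constant.
  abstract

    inBall : ℚ → ℚ → ℚ → Bool
    inBall c r x = does (double (sq (x - c)) <? sq r)

    inBall-true : ∀ {c r x} → double (sq (x - c)) < sq r → inBall c r x ≡ true
    inBall-true = dec-true (_ <? _)

    inBall-false : ∀ {c r x} → ¬ (double (sq (x - c)) < sq r) → inBall c r x ≡ false
    inBall-false = dec-false (_ <? _)

    true-inBall : ∀ {c r x} → inBall c r x ≡ true → double (sq (x - c)) < sq r
    true-inBall {c} {r} {x} e = does-true (double (sq (x - c)) <? sq r) e

    inBall-cong : ∀ c r x y → (double (sq (y - c)) < sq r → double (sq (x - c)) < sq r) →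
                  (double (sq (x - c)) < sq r → double (sq (y - c)) < sq r) → inBall c r y ≡ inBall c r x
    inBall-cong c r x y = does-cong (double (sq (y - c)) <? sq r) (double (sq (x - c)) <? sq r)

  LocallyConstant : (ℚ → Bool) → Set
  LocallyConstant P = ∀ x → Nearby x (λ y → P y ≡ P x)

  near-below : ∀ X Y R → ∣ X - Y ∣ < R - Y → X < R
  near-below X Y R lt = -‿cancelʳ-< X R Y (≤-<-trans (p≤∣p∣ (X - Y)) lt)

  near-above : ∀ X Y R → ∣ X - Y ∣ < Y - R → R < X
  near-above X Y R lt = -‿cancelˡ-< X R Y (≤-<-trans (p≤∣p∣ (Y - X)) (subst (_< Y - R) (∣p-q∣-sym X Y) lt))

  -‿shift : ∀ c x y → y - x ≡ (y - c) - (x - c)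
  -‿shift = solve 3 (λ c x y → y :- x := (y :- c) :- (x :- c)) refl
    where open +-*-Solver

  inBall-locally-constant : ∀ c r → r ≢ 0ℚ → LocallyConstant (inBall c r)
  inBall-locally-constant c r r≢0 x = go (<-cmp (double (sq (x - c))) (sq r))
    where
    Y = double (sq (x - c))
    R = sq r
    X : ℚ → ℚ
    X y = double (sq (y - c))
    from : ∀ η → 0ℚ < η → (∀ y → ∣ X y - Y ∣ < η → (X y < R → Y < R) × (Y < R → X y < R)) → Nearby x
            (λ y → inBall c r y ≡ inBall c r x)
    from η 0<η h = let ε , 0<ε , near = double-sq-continuous (x - c) η 0<η in ε , 0<ε , λ y lt →
      let f , g = h y (near (y - c) (subst (λ z → ∣ z ∣ < ε) (-‿shift c x y) lt)) in inBall-cong c r x y f g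
    go : _ → Nearby x (λ y → inBall c r y ≡ inBall c r x)
    go (tri< lt _ _) = from (R - Y) (<⇒0<- lt) λ y h → (λ _ → lt) , λ _ → near-below (X y) Y R h
    go (tri> ¬lt _ gt) = from (Y - R) (<⇒0<- gt) λ y h → (λ lt → contradiction lt
            (<-asym (near-above (X y) Y R h))) , λ lt → contradiction lt ¬lt
    -- Equality forces `x - c = 0`, hence `sq r = 0`; irrationality, used again with right-hand root
    -- `0ℚ`, turns this into `r = 0`.
    go (tri≈ _ eq _) = contradiction (√2-irrationalℚ r 0ℚ (cong double
            (trans (sym eq) (cong (double ∘ sq) (√2-irrationalℚ (x - c) r eq))))) r≢0

  inBall-small : ∀ {c r x} → 0ℚ < r → inBall c r x ≡ true → ∣ x - c ∣ < r
  inBall-small {c} {r} {x} 0<r e with ∣ x - c ∣ <? r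
  ... | yes lt = lt
  ... | no ¬lt = contradiction (true-inBall {c} {r} {x} e) (≤⇒≯ (begin
    sq r               ≤⟨ sq-mono-≤ (<⇒≤ 0<r) (≮⇒≥ ¬lt) ⟩
    sq ∣ x - c ∣        ≡⟨ sq-abs (x - c) ⟩
    sq (x - c)         ≡⟨ +-identityʳ _ ⟨
    sq (x - c) + 0ℚ    ≤⟨ +-monoʳ-≤ (sq (x - c)) (0≤sq (x - c)) ⟩
    double (sq (x - c)) ∎))
    where open ≤-Reasoning
          ≤⇒≯ : ∀ {p q} → p ≤ q → ¬ (q < p)
          ≤⇒≯ le lt = <-irrefl refl (≤-<-trans le lt)

  -- The Archimedean property and halved radii

  nat pow : ℕ → ℚ
  nat zero    = 0ℚ
  nat (suc n) = 1ℚ + nat n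
  pow zero    = 1ℚ
  pow (suc n) = double (pow n)

  1≤pow : ∀ n → 1ℚ ≤ pow n
  1≤pow zero    = ≤-refl
  1≤pow (suc n) = ≤-trans (1≤pow n) (subst (_≤ double (pow n)) (+-identityʳ (pow n))
          (+-monoʳ-≤ (pow n) (≤-trans (<⇒≤ 0<1) (1≤pow n))))

  nat≤pow : ∀ n → nat n ≤ pow n
  nat≤pow zero    = <⇒≤ 0<1
  nat≤pow (suc n) = +-mono-≤ (1≤pow n) (nat≤pow n)

  toℚᵘ-nat : ∀ n → toℚᵘ (nat n) ℚᵘ.≃ ℚᵘ.mkℚᵘ (+ n) 0
  toℚᵘ-nat zero    = ℚᵘ.*≡* refl
  toℚᵘ-nat (suc n) = ℚᵘₚ.≃-trans (toℚᵘ-homo-+ 1ℚ (nat n)) (ℚᵘₚ.≃-trans (ℚᵘₚ.+-congʳ (toℚᵘ 1ℚ) (toℚᵘ-nat n))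
    (ℚᵘ.*≡* (solve 1 (λ m → (con (+ 1) :* con (+ 1) :+ m :* con (+ 1)) :* con (+ 1) := (con (+ 1) :+ m) :* con
            (+ 1)) refl (+ n))))
    where open Data.Integer.Solver.+-*-Solver

  i≤∣i∣*suc : ∀ i d → i ℤ.* + 1 ℤ.≤ + ℤ.∣ i ∣ ℤ.* + suc d
  i≤∣i∣*suc i d = begin
    i ℤ.* + 1                 ≡⟨ ℤₚ.*-identityʳ i ⟩
    i                         ≤⟨ i≤∣i∣ i ⟩
    + ℤ.∣ i ∣                 ≤⟨ ℤ.+≤+ (ℕₚ.m≤m*n ℤ.∣ i ∣ (suc d)) ⟩
    + (ℤ.∣ i ∣ ℕ.* suc d)     ≡⟨ ℤₚ.pos-* ℤ.∣ i ∣ (suc d) ⟩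
    + ℤ.∣ i ∣ ℤ.* + suc d     ∎
    where
    open ℤₚ.≤-Reasoning
    i≤∣i∣ : ∀ i → i ℤ.≤ + ℤ.∣ i ∣
    i≤∣i∣ (+ n)    = ℤₚ.≤-refl
    i≤∣i∣ -[1+ n ] = ℤ.-≤+

  archimedean : ∀ p → p ≤ nat ℤ.∣ ↥ p ∣
  archimedean p@(mkℚ i d _) = toℚᵘ-cancel-≤ (ℚᵘₚ.≤-respʳ-≃ (ℚᵘₚ.≃-sym (toℚᵘ-nat ℤ.∣ i ∣)) (ℚᵘ.*≤* (i≤∣i∣*suc i d)))

  half : ℚ → ℚ
  half r = ½ * r

  double-half : ∀ r → double (half r) ≡ r
  double-half = solve 1 (λ r → con ½ :* r :+ con ½ :* r := r) refl
    where open +-*-Solver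

  0<half : ∀ {r} → 0ℚ < r → 0ℚ < half r
  0<half = 0<* (positive⁻¹ ½)

  half< : ∀ {r} → 0ℚ < r → half r < r
  half< {r} 0<r = subst₂ _<_ (+-identityʳ (half r)) (double-half r) (+-monoʳ-< (half r) (0<half 0<r))

  halves : ℚ → ℕ → ℚ
  halves r zero    = r
  halves r (suc g) = half (halves r g)

  0<halves : ∀ {r} g → 0ℚ < r → 0ℚ < halves r g
  0<halves zero    0<r = 0<r
  0<halves (suc g) 0<r = 0<half (0<halves g 0<r)

  halves-pow : ∀ r g → halves r g * pow g ≡ r
  halves-pow r zero    = *-identityʳ r
  halves-pow r (suc g) = trans (solve 2 (λ x p → con ½ :* x :* (p :+ p) := x :* p) refl (halves r g) (pow g)) (halves-pow r g)
    where open +-*-Solver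

  halves-small : ∀ {r ε} → 0ℚ < r → 0ℚ < ε → ∃ λ g → halves r g ≤ ε
  halves-small {r} {ε} 0<r 0<ε = g , *-cancelʳ-≤-pos (pow g) {{positive (<-≤-trans 0<1 (1≤pow g))}} le
    where
    inv = 1/-pos 0<ε
    i = proj₁ inv
    -- As `r * i` is `r / ε` and is at most `nat g ≤ pow g`, `g` halvings bring `r` down to `ε` or
    -- less.
    g = ℤ.∣ ↥ (r * i) ∣
    open ≤-Reasoning
    le : halves r g * pow g ≤ ε * pow g
    le = begin
      halves r g * pow g ≡⟨ halves-pow r g ⟩
      r                  ≡⟨ *-identityʳ r ⟨
      r * 1ℚ             ≡⟨ cong (r *_) (proj₂ (proj₂ inv)) ⟨
      r * (i * ε)        ≡⟨ *-assoc r i ε ⟨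
      r * i * ε          ≤⟨ *-monoʳ-≤-nonNeg ε {{nonNegative (<⇒≤ 0<ε)}} (≤-trans (archimedean (r * i)) (nat≤pow g)) ⟩
      pow g * ε          ≡⟨ *-comm (pow g) ε ⟩
      ε * pow g          ∎

  halves-antitone : ∀ {r g h} → 0ℚ < r → g ℕ.≤ h → halves r h ≤ halves r g
  halves-antitone {r} {g} {h} 0<r g≤h = go (ℕₚ.≤⇒≤′ g≤h)
    where
    go : ∀ {h} → g ℕ.≤′ h → halves r h ≤ halves r g
    go ℕ.≤′-refl       = ≤-refl
    go (ℕ.≤′-step {n} p) = ≤-trans (<⇒≤ (half< (0<halves n 0<r))) (go p)

  -- An enumeration of ℚ

  unpair-step : ℕ × ℕ → ℕ × ℕ
  unpair-step (zero  , b) = suc b , zero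
  unpair-step (suc a , b) = a , suc b

  -- Cantor's walk along the antidiagonals: from the end `(0 , b)` of one it jumps to the start
  -- `(suc b , 0)` of the next.
  unpair : ℕ → ℕ × ℕ
  unpair zero    = zero , zero
  unpair (suc n) = unpair-step (unpair n)

  unpair-onto′ : ∀ t b a → a ℕ.+ b ≡ t → ∃ λ n → unpair n ≡ (a , b)
  unpair-onto′ t zero zero _ = 0 , refl
  unpair-onto′ (suc t) zero (suc a) eq with unpair-onto′ t a 0 (trans (sym (ℕₚ.+-identityʳ a)) (ℕₚ.suc-injective eq))
  ... | n , h = suc n , cong unpair-step h
  unpair-onto′ t (suc b) a eq with unpair-onto′ t b (suc a) (trans (sym (ℕₚ.+-suc a b)) eq)
  ... | n , h = suc n , cong unpair-step h

  unpair-onto : ∀ a b → ∃ λ n → unpair n ≡ (a , b)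
  unpair-onto a b = unpair-onto′ _ b a refl

  toℤ : ℕ × ℕ → ℤ
  toℤ (a , b) = + a ℤ.- + b

  toℤ-onto : ∀ i → ∃ λ p → toℤ p ≡ i
  toℤ-onto (+ n)    = (n , 0) , ℤₚ.+-identityʳ (+ n)
  toℤ-onto -[1+ n ] = (0 , suc n) , refl

  fraction : ℕ × ℕ → ℚ
  fraction (i , d) = toℤ (unpair i) / suc d

  abstract

    enum : ℕ → ℚ
    enum n = fraction (unpair n)

    enum-onto : ∀ p → ∃ λ n → enum n ≡ p
    enum-onto p@(mkℚ i d _) =
      let ab , eq = toℤ-onto i ; j , eqj = unpair-onto (proj₁ ab) (proj₂ ab) ; n , eqn = unpair-onto j d
      in n , trans (cong fraction eqn) (trans (cong (λ i → i / suc d) (trans (cong toℤ eqj) eq)) (↥p/↧p≡p p))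

  -- Neighbourhoods and open tests

  0<⊓ : ∀ {p q} → 0ℚ < p → 0ℚ < q → 0ℚ < p ⊓ q
  0<⊓ {p} {q} 0<p 0<q with ⊓-sel p q
  ... | inj₁ e = subst (0ℚ <_) (sym e) 0<p
  ... | inj₂ e = subst (0ℚ <_) (sym e) 0<q

  Nearby-× : ∀ {x P Q} → Nearby x P → Nearby x Q → Nearby x (λ y → P y × Q y)
  Nearby-× (ε , 0<ε , p) (δ , 0<δ , q) = ε ⊓ δ , 0<⊓ 0<ε 0<δ , λ y lt →
    p y (<-≤-trans lt (p⊓q≤p ε δ)) , q y (<-≤-trans lt (p⊓q≤q ε δ))

  Nearby-map : ∀ {x P Q} → (∀ {y} → P y → Q y) → Nearby x P → Nearby x Q
  Nearby-map f (ε , 0<ε , p) = ε , 0<ε , λ y lt → f (p y lt)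

  OpenTest : (ℚ → Bool) → Set
  OpenTest P = ∀ x → P x ≡ true → Nearby x (λ y → P y ≡ true)

  ∧-join : ∀ {a b} → a ≡ true → b ≡ true → a ∧ b ≡ true
  ∧-join refl refl = refl

  true≢false : ∀ {a} → a ≡ true → a ≡ false → ⊥
  true≢false refl ()

  open-∧ : ∀ {P Q} → OpenTest P → OpenTest Q → OpenTest (λ x → P x ∧ Q x)
  open-∧ {P} {Q} p q x h = let a , b = ∧-split {P x} h in
    Nearby-map (λ (u , v) → ∧-join u v) (Nearby-× (p x a) (q x b))

  open-lc : ∀ {P} → LocallyConstant P → OpenTest P
  open-lc lc x h = Nearby-map (λ e → trans e h) (lc x)

  lc-not : ∀ {P} → LocallyConstant P → LocallyConstant (not ∘ P)
  lc-not lc x = Nearby-map (cong not) (lc x)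

  ∣x-x∣<ε : ∀ x {ε} → 0ℚ < ε → ∣ x - x ∣ < ε
  ∣x-x∣<ε x {ε} 0<ε = subst (λ z → ∣ z ∣ < ε) (sym (+-inverseʳ x)) 0<ε

  0<∣x-c∣ : ∀ x c → x ≢ c → 0ℚ < ∣ x - c ∣
  0<∣x-c∣ x c x≢c with 0ℚ <? ∣ x - c ∣
  ... | yes lt = lt
  ... | no ¬lt = contradiction (trans (solve 2 (λ x c → x := x :- c :+ c) refl x c)
                   (trans (cong (_+ c) (∣p∣≡0⇒p≡0 (x - c) (≤-antisym (≮⇒≥ ¬lt) (0≤∣p∣ (x - c))))) (+-identityˡ c))) x≢c
    where open +-*-Solver

  0<sq : ∀ {r} → 0ℚ < r → 0ℚ < sq r
  0<sq 0<r = 0<* 0<r 0<r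

  -- The centre of a cell is its first element in the enumeration of ℚ.  Irrational radii tending to 0
  -- cut the rest of the cell into shells around the centre, which are cells of higher rank, so every
  -- rational is the centre of exactly one iterated shell of ℚ.
  record Cell : Set where
    field
      test    : ℚ → Bool
      isOpen  : OpenTest test
      -- Any element will do: it bounds the search for the first one in the enumeration.
      point   : ℚ
      point∈  : test point ≡ true

    abstract

      search : ∃ λ m → test (enum m) ≡ true × m ℕ.≤ proj₁ (enum-onto point) × (∀ {k} → k ℕ.< m → test (enum k) ≡ false)
      search = least (test ∘ enum) (proj₁ (enum-onto point)) (trans (cong test (proj₂ (enum-onto point))) point∈)

      room : ∃ λ ε → 0ℚ < ε × Within (enum (proj₁ search)) ε (λ y → test y ≡ true)
      room = isOpen (enum (proj₁ search)) (proj₁ (proj₂ search))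

    rank : ℕ
    rank = proj₁ search

    centre : ℚ
    centre = enum rank

    centre∈ : test centre ≡ true
    centre∈ = proj₁ (proj₂ search)

    rank-least : ∀ {k} → test (enum k) ≡ true → rank ℕ.≤ k
    rank-least h = ℕₚ.≮⇒≥ λ lt → true≢false h (proj₂ (proj₂ (proj₂ search)) lt)

    radius : ℕ → ℚ
    radius = halves (half (proj₁ room))

    0<radius : ∀ g → 0ℚ < radius g
    0<radius g = 0<halves g (0<half (proj₁ (proj₂ room)))

    inside before : ℕ → ℚ → Bool
    inside g = inBall centre (radius g)
    before zero    _ = true
    before (suc g) x = inside g x

    shell : ℕ → ℚ → Bool
    shell g x = test x ∧ not (inside g x) ∧ before g x

    inside-lc : ∀ g → LocallyConstant (inside g)
    inside-lc g = inBall-locally-constant centre (radius g) (λ e → <-irrefl (sym e) (0<radius g))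

    before-open : ∀ g → OpenTest (before g)
    before-open zero    x _ = 1ℚ , 0<1 , λ _ _ → refl
    before-open (suc g) = open-lc (inside-lc g)

    shell-open : ∀ g → OpenTest (shell g)
    shell-open g = open-∧ {test} isOpen (open-∧ {not ∘ inside g} (open-lc (lc-not (inside-lc g))) (before-open g))

    shell-split : ∀ {g x} → shell g x ≡ true → test x ≡ true × inside g x ≡ false × before g x ≡ true
    shell-split {g} {x} h = let a , b = ∧-split {test x} h ; c , d = ∧-split {not (inside g x)} b in a , not-injective c , d

    shell-join : ∀ {g x} → test x ≡ true → inside g x ≡ false → before g x ≡ true → shell g x ≡ true
    shell-join {g} {x} a b c = ∧-join {test x} a (∧-join {not (inside g x)} (cong not b) c)

    inside-antitone : ∀ {g h x} → g ℕ.≤ h → inside h x ≡ true → inside g x ≡ true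
    inside-antitone {g} {h} {x} g≤h e = inBall-true {centre} {radius g} {x} (<-≤-trans (true-inBall {centre} {radius h} {x} e)
      (sq-mono-≤ (<⇒≤ (0<radius h)) (halves-antitone (0<half (proj₁ (proj₂ room))) g≤h)))

    before-inside : ∀ {g h x} → g ℕ.< h → before h x ≡ true → inside g x ≡ true
    before-inside {g} {suc h} {x} (ℕ.s≤s g≤h) e = inside-antitone {g} {h} {x} g≤h e

    inside-centre : ∀ g → inside g centre ≡ true
    inside-centre g = inBall-true {centre} {radius g} {centre}
      (subst (λ z → double (sq z) < sq (radius g)) (sym (+-inverseʳ centre)) (0<sq (0<radius g)))

    -- Shells are never empty: distance `radius g` lies outside the ball of true radius
    -- `radius g / √2`, and inside the previous one, whose true radius is `√2` times `radius g`
    -- because radii are halved.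
    witness : ℕ → ℚ
    witness g = centre + radius g

    witness-centre : ∀ g → witness g - centre ≡ radius g
    witness-centre g = solve 2 (λ c r → c :+ r :- c := r) refl centre (radius g)
      where open +-*-Solver

    witness∈ : ∀ g → shell g (witness g) ≡ true
    witness∈ g = shell-join {g} test∈ outside′ (before′ g)
      where
      open ≤-Reasoning
      close : ∣ witness g - centre ∣ < proj₁ room
      close = begin-strict
        ∣ witness g - centre ∣ ≡⟨ cong ∣_∣ (witness-centre g) ⟩
        ∣ radius g ∣           ≡⟨ 0≤p⇒∣p∣≡p (<⇒≤ (0<radius g)) ⟩
        radius g               ≤⟨ halves-antitone {g = 0} {h = g} (0<half (proj₁ (proj₂ room))) ℕ.z≤n ⟩
        half (proj₁ room)      <⟨ half< (proj₁ (proj₂ room)) ⟩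
        proj₁ room             ∎
      test∈ : test (witness g) ≡ true
      test∈ = proj₂ (proj₂ room) (witness g) close
      outside′ : inside g (witness g) ≡ false
      outside′ = inBall-false {centre} {radius g} {witness g} λ lt → <-irrefl refl
              (<-≤-trans (subst (λ z → double (sq z) < sq (radius g)) (witness-centre g) lt)
        (subst (_≤ double (sq (radius g))) (+-identityʳ (sq (radius g))) (+-monoʳ-≤ (sq (radius g)) (0≤sq (radius g)))))
      before′ : ∀ g → before g (witness g) ≡ true
      before′ zero    = refl
      before′ (suc g) = inBall-true {centre} {radius g} {witness (suc g)}
        (subst₂ (λ z w → double (sq z) < sq w) (sym (witness-centre (suc g))) (double-half (radius g))
                (lt (radius (suc g)) (0<radius (suc g))))
        where
        lt : ∀ r → 0ℚ < r → double (sq r) < sq (double r)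
        lt r 0<r = subst₂ _<_ (+-identityʳ (double (sq r))) (solve 1
                (λ r → r :* r :+ r :* r :+ (r :* r :+ r :* r) := (r :+ r) :* (r :+ r)) refl r)
                     (+-monoʳ-< (double (sq r)) (0<+ (0<sq 0<r) (0<sq 0<r)))
          where open +-*-Solver

    -- The shell of `x` is given by the first ball that misses `x`. The search is bounded by an `n`
    -- with `radius n ≤ ∣ x - centre ∣`, where `x` is certainly outside.
    shell-exists : ∀ {x} → test x ≡ true → x ≢ centre → ∃ λ g → shell g x ≡ true
    shell-exists {x} x∈ x≢c with halves-small (0<half (proj₁ (proj₂ room))) (0<∣x-c∣ x centre x≢c)
    ... | n , small-n with least (λ g → not (inside g x)) n (cong not (far (inside n x) refl))
      where
      far : ∀ b → inside n x ≡ b → inside n x ≡ false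
      far false e = e
      far true  e = contradiction (<-≤-trans (inBall-small {centre} {radius n} {x} (0<radius n) e) small-n) (<-irrefl refl)
    ... | zero  , out , _ , _  = 0 , shell-join {0} x∈ (not-injective out) refl
    ... | suc m , out , _ , lo = suc m , shell-join {suc m} x∈ (not-injective out) (not-injective (lo ℕₚ.≤-refl))

    shell-unique : ∀ {g h x} → shell g x ≡ true → shell h x ≡ true → g ≡ h
    shell-unique {g} {h} {x} p q with ℕₚ.<-cmp g h
    ... | tri≈ _ e _ = e
    ... | tri< lt _ _ = ⊥-elim (true≢false (before-inside {g} {h} {x} lt (proj₂ (proj₂ (shell-split {h} {x} q))))
            (proj₁ (proj₂ (shell-split {g} {x} p))))
    ... | tri> _ _ gt = ⊥-elim (true≢false (before-inside {h} {g} {x} gt (proj₂ (proj₂ (shell-split {g} {x} p))))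
            (proj₁ (proj₂ (shell-split {h} {x} q))))

    centre∉shell : ∀ g → shell g centre ≡ false
    centre∉shell g with shell g centre in e
    ... | false = refl
    ... | true  = ⊥-elim (true≢false (inside-centre g) (proj₁ (proj₂ (shell-split {g} {centre} e))))

    sub : ℕ → Cell
    sub g = record { test = shell g ; isOpen = shell-open g ; point = witness g ; point∈ = witness∈ g }

  -- Lists as addresses of rationals

  open Cell

  sub-⊆ : ∀ C {g x} → test (sub C g) x ≡ true → test C x ≡ true
  sub-⊆ C {g} {x} h = proj₁ (shell-split C {g} {x} h)

  -- Every shell loses the first element of `C`, so the least index strictly rises; this is the
  -- measure behind surjectivity.
  rank-sub : ∀ C g → rank C ℕ.< rank (sub C g)
  rank-sub C g = ℕₚ.≤∧≢⇒< (rank-least C (sub-⊆ C {g} {centre (sub C g)} (centre∈ (sub C g))))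
    λ e → true≢false (centre∈ (sub C g)) (subst (λ k → shell C g (enum k) ≡ false) e (centre∉shell C g))

  locate : Cell → List ℕ → ℚ
  locate C []      = centre C
  locate C (g ∷ l) = locate (sub C g) l

  locate∈ : ∀ C l → test C (locate C l) ≡ true
  locate∈ C []      = centre∈ C
  locate∈ C (g ∷ l) = sub-⊆ C {g} {locate (sub C g) l} (locate∈ (sub C g) l)

  -- Passing to the shell that contains `enum m` raises the rank, and the rank of a cell containing
  -- `enum m` is at most `m`; hence the fuel `n` suffices.
  locate-onto′ : ∀ n C m → test C (enum m) ≡ true → m ℕ.< n ℕ.+ rank C → ∃ λ l → locate C l ≡ enum m
  locate-onto′ zero C m h lt = contradiction lt (ℕₚ.≤⇒≯ (rank-least C h))
  locate-onto′ (suc n) C m h lt = go (enum m ≟ centre C)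
    where
    go : Dec (enum m ≡ centre C) → ∃ λ l → locate C l ≡ enum m
    go (yes e) = [] , sym e
    go (no ¬e) = let g , h′ = shell-exists C h ¬e
                     l , e = locate-onto′ n (sub C g) m h′ (ℕₚ.≤-trans lt
                             (ℕₚ.≤-trans (ℕₚ.≤-reflexive (sym (ℕₚ.+-suc n (rank C)))) (ℕₚ.+-monoʳ-≤ n (rank-sub C g))))
                 in g ∷ l , e

  locate-onto : ∀ C x → test C x ≡ true → ∃ λ l → locate C l ≡ x
  locate-onto C x h with enum-onto x
  ... | m , refl = locate-onto′ (suc m) C m h (ℕ.s≤s (ℕₚ.m≤m+n m (rank C)))

  locate-injective : ∀ C l l′ → locate C l ≡ locate C l′ → l ≡ l′
  locate-injective C [] [] e = refl
  locate-injective C [] (g ∷ l) e = ⊥-elim (true≢false (subst (λ x → shell C g x ≡ true) (sym e)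
          (locate∈ (sub C g) l)) (centre∉shell C g))
  locate-injective C (g ∷ l) [] e = ⊥-elim (true≢false (subst (λ x → shell C g x ≡ true) e (locate∈ (sub C g) l))
          (centre∉shell C g))
  locate-injective C (g ∷ l) (h ∷ m) e with shell-unique C {g} {h} (locate∈ (sub C g) l)
          (subst (λ x → shell C h x ≡ true) (sym e) (locate∈ (sub C h) m))
  ... | refl = cong (g ∷_) (locate-injective (sub C g) l m e)

  locate-continuous : ∀ C l {ε} → 0ℚ < ε → ∃ λ n → ∀ {l′} → Near id n l l′ → ∣ locate C l′ - locate C l ∣ < ε
  locate-continuous C (g ∷ l) 0<ε with locate-continuous (sub C g) l 0<ε
  ... | n , h = n , λ { stay → ∣x-x∣<ε (locate (sub C g) l) 0<ε ; (keep r) → h r }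
  locate-continuous C [] 0<ε with halves-small (0<half (proj₁ (proj₂ (room C)))) 0<ε
  ... | n , le = suc n , λ { stay → ∣x-x∣<ε (centre C) 0<ε ; (leave {g} {l} n<g) → <-≤-trans
    (inBall-small {centre C} {radius C n} {locate (sub C g) l} (0<radius C n)
      (before-inside C {n} {g} n<g (proj₂ (proj₂ (shell-split C {g} (locate∈ (sub C g) l)))))) le }

  -- The last cell on the path is open, and its `n`-th ball meets only the centre and shells of
  -- index at least `n`. This is continuity of the inverse of `locate`.
  locate-open : ∀ C l n → Nearby (locate C l) (λ y → ∃ λ l′ → Near id n l l′ × locate C l′ ≡ y)
  locate-open C (g ∷ l) n = Nearby-map (λ (l′ , r , e) → g ∷ l′ , keep r , e) (locate-open (sub C g) l n)
  locate-open C [] n = Nearby-map (λ {y} (a , b) → find y a (trans b (inside-centre C n)))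
          (Nearby-× (isOpen C (centre C) (centre∈ C)) (inside-lc C n (centre C)))
    where
    find : ∀ y → test C y ≡ true → inside C n y ≡ true → ∃ λ l′ → Near id n [] l′ × locate C l′ ≡ y
    find y y∈ y-in = go (y ≟ centre C)
      where
      go : Dec (y ≡ centre C) → ∃ λ l′ → Near id n [] l′ × locate C l′ ≡ y
      go (yes e) = [] , stay , sym e
      go (no ¬e) = let g , h = shell-exists C y∈ ¬e
                       l , e = locate-onto (sub C g) y h
                       n≤g = ℕₚ.≮⇒≥ λ g<n → true≢false (inside-antitone C {g} {n} {y} (ℕₚ.<⇒≤ g<n) y-in)
                                                        (proj₁ (proj₂ (shell-split C {g} {y} h)))
                   in g ∷ l , leave n≤g , e

  top : Cell
  top = record { test = λ _ → true ; isOpen = λ _ _ → 1ℚ , 0<1 , λ _ _ → refl ; point = 0ℚ ; point∈ = refl }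

  abstract

    point-of : List ℕ → ℚ
    point-of = locate top

    code : ℚ → List ℕ
    code x = proj₁ (locate-onto top x refl)

    point-code : ∀ x → point-of (code x) ≡ x
    point-code x = proj₂ (locate-onto top x refl)

    code-point : ∀ l → code (point-of l) ≡ l
    code-point l = locate-injective top _ l (point-code (point-of l))

    code-continuous : ∀ x n → Nearby x (λ y → Near id n (code x) (code y))
    code-continuous x n = subst (λ x′ → Nearby x′ (λ y → Near id n (code x) (code y))) (point-code x)
      (Nearby-map (λ { (l , r , refl) → subst (Near id n (code x)) (sym (code-point l)) r }) (locate-open top (code x) n))

    point-continuous : ∀ l {ε} → 0ℚ < ε → ∃ λ n → ∀ {l′} → Near id n l l′ → ∣ point-of l′ - point-of l ∣ < ε
    point-continuous = locate-continuous top

-- The dynamical system on ℚ of a transition system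

-- The moves lead upwards, `default` chooses a successor, and `follow w v j` is the move by which a
-- successor `v` of `w` answers the move `j`: forward confluence with explicit witnesses.
module Dynamics {W : Set} {b : ℕ} (move : Fin (suc b) → W → W) (default : W → W)
  (follow : W → W → Fin (suc b) → Fin (suc b)) (S : W → W → Set)
  (S-default : ∀ w → S w (default w)) (S-move : ∀ {w v} j → S w v → S (move j w) (move (follow w v j) v))
  (state : ℕ → W) (index : W → ℕ) (size : ℕ) (index< : ∀ w → index w ℕ.< size) (state-index : ∀ w → state (index w) ≡ w)
  where

  open import Data.List.Properties using (map-++; map-∘; map-id; map-cong)
  open import Data.Nat.Divisibility using (divides-refl)
  open import Data.Nat.DivMod
    using (_/_; m%n<n; [m+kn]%n≡m%n; m<n⇒m%n≡m; m<n⇒m/n≡0; m*n/n≡m; +-distrib-/-∣ʳ; /-monoˡ-≤)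
  open import Data.Rational using (0ℚ; _-_; ∣_∣)
  open import Defs using (Continuous; iter)
  open Rationals

  -- Paths and the shift map

  Move : Set
  Move = Fin (suc b)

  -- A point (w , (a₁ , j₁) ∷ (a₂ , j₂) ∷ …) stands for the sequence of states that stays at w for a₁
  -- time steps, then makes the move j₁, stays for a₂ steps, makes the move j₂, and so on.
  Script : Set
  Script = List (ℕ × Move)

  Point : Set
  Point = W × Script

  final : W → Script → W
  final w []            = w
  final w ((_ , j) ∷ l) = final (move j w) l

  -- The moves of the successor v of w that keep it a successor while w performs a script.
  shadow : W → W → Script → Script
  shadow w v []            = []
  shadow w v ((a , j) ∷ l) = (a , follow w v j) ∷ shadow (move j w) (move (follow w v j) v) l

  start : W → Script → Point
  start w l = default w , shadow w (default w) l

  shift : Point → Point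
  shift (w , [])                = start w []
  shift (w , (zero , j) ∷ l)    = start (move j w) l
  shift (w , (suc a , j) ∷ l)   = start w ((a , j) ∷ l)

  -- The theory of a point is read off at the end of its path. Late extra moves are small changes,
  -- so nearby limits arise from this one by further moves, and the result of each single move
  -- occurs arbitrarily close.
  limit : Point → W
  limit (w , l) = final w l

  S-final : ∀ {w v} l → S w v → S (final w l) (final v (shadow w v l))
  S-final []            σ = σ
  S-final ((_ , j) ∷ l) σ = S-final l (S-move j σ)

  S-limit : ∀ y → S (limit y) (limit (shift y))
  S-limit (w , [])              = S-default w
  S-limit (w , (zero , j) ∷ l)  = S-final l (S-default (move j w))
  S-limit (w , (suc a , j) ∷ l) = S-final ((a , j) ∷ l) (S-default w)

  infix 4 _≈[_]_
  _≈[_]_ : Point → ℕ → Point → Set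
  (w , l) ≈[ n ] (w′ , l′) = w ≡ w′ × Near proj₁ n l l′

  Near-weaken : ∀ {n l l′} → Near {ℕ × Move} proj₁ (suc n) l l′ → Near proj₁ n l l′
  Near-weaken stay      = stay
  Near-weaken (leave p) = leave (ℕₚ.<⇒≤ p)
  Near-weaken (keep r)  = keep (Near-weaken r)

  shadow-near : ∀ {n w v l l′} → Near proj₁ n l l′ → Near proj₁ n (shadow w v l) (shadow w v l′)
  shadow-near stay      = stay
  shadow-near (leave p) = leave p
  shadow-near (keep r)  = keep (shadow-near r)

  -- A shift uses up one time step of the first wait, which costs one level of closeness.
  shift-near : ∀ {n y y′} → y ≈[ suc n ] y′ → shift y ≈[ n ] shift y′
  shift-near (refl , stay)                          = refl , stay
  shift-near (refl , leave {suc a , j} (ℕ.s≤s p))   = refl , leave p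
  shift-near (refl , keep {zero , j} r)             = refl , shadow-near (Near-weaken r)
  shift-near (refl , keep {suc a , j} r)            = refl , keep (shadow-near (Near-weaken r))

  limit-near : ∀ {P : W → Set} → (∀ {w} j → P w → P (move j w)) → ∀ {n y y′} → y ≈[ n ] y′ → P (limit y) → P (limit y′)
  limit-near {P} mono {y = w , _} (refl , r) = go r
    where
    stable : ∀ {w} l → P w → P (final w l)
    stable []            p = p
    stable ((_ , j) ∷ l) p = stable l (mono j p)
    go : ∀ {n w l l′} → Near proj₁ n l l′ → P (final w l) → P (final w l′)
    go stay p = p
    go (leave {a , j} {l} _) p = stable l (mono j p)
    go (keep r) p = go r p

  duration : Script → ℕ
  duration []            = 0
  duration ((a , _) ∷ l) = suc (a ℕ.+ duration l)

  shadow-duration : ∀ w v l → duration (shadow w v l) ≡ duration l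
  shadow-duration w v []            = refl
  shadow-duration w v ((a , j) ∷ l) = cong (λ d → suc (a ℕ.+ d)) (shadow-duration _ _ l)

  -- Each shift lowers the duration by one, and `shadow` preserves it. From some time on the orbit
  -- is thus that of one state under `default`.
  settles : ∀ t w l → duration l ℕ.≤ t → ∃ λ n → ∃ λ v → fold (w , l) shift n ≡ (v , [])
  settles t w [] _ = 0 , w , refl
  settles (suc t) w ((zero , j) ∷ l) (ℕ.s≤s le) =
    let n , v , e = settles t (default w′) (shadow w′ (default w′) l)
            (subst (ℕ._≤ t) (sym (shadow-duration w′ (default w′) l)) le)
    in suc n , v , trans (sym (fold-shift shift _ n)) e
    where w′ = move j w
  settles (suc t) w ((suc a , j) ∷ l) (ℕ.s≤s le) =
    let n , v , e = settles t (default w) (shadow w (default w) ((a , j) ∷ l))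
            (subst (ℕ._≤ t) (sym (shadow-duration w (default w) ((a , j) ∷ l))) le)
    in suc n , v , trans (sym (fold-shift shift _ n)) e

  final-++ : ∀ w l a j → final w (l ++ (a , j) ∷ []) ≡ move j (final w l)
  final-++ w []            a j = refl
  final-++ w ((_ , i) ∷ l) a j = final-++ (move i w) l a j

  -- Points as lists of natural numbers

  enc : ℕ × Move → ℕ
  enc (a , j) = Fin.toℕ j ℕ.+ a ℕ.* suc b

  dec : ℕ → ℕ × Move
  dec g = g / suc b , Fin.fromℕ< (m%n<n g (suc b))

  dec-enc : ∀ p → dec (enc p) ≡ p
  dec-enc (a , j) = cong₂ _,_
    (trans (+-distrib-/-∣ʳ (Fin.toℕ j) (divides-refl a)) (cong₂ ℕ._+_ (m<n⇒m/n≡0 (Finₚ.toℕ<n j)) (m*n/n≡m a (suc b))))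
    (Finₚ.toℕ-injective (trans (Finₚ.toℕ-fromℕ< _) (trans ([m+kn]%n≡m%n (Fin.toℕ j) a (suc b)) (m<n⇒m%n≡m (Finₚ.toℕ<n j)))))

  enc-gap : ∀ {n} p → n ℕ.≤ proj₁ p → n ℕ.≤ enc p
  enc-gap (a , j) le = ℕₚ.≤-trans le (ℕₚ.≤-trans (ℕₚ.m≤m*n a (suc b)) (ℕₚ.m≤n+m (a ℕ.* suc b) (Fin.toℕ j)))

  dec-gap : ∀ {n} g → n ℕ.* suc b ℕ.≤ g → n ℕ.≤ proj₁ (dec g)
  dec-gap {n} g le = subst (ℕ._≤ g / suc b) (m*n/n≡m n (suc b)) (/-monoˡ-≤ (suc b) le)

  enc-near : ∀ {n l l′} → Near proj₁ n l l′ → Near id n (map enc l) (map enc l′)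
  enc-near stay = stay
  enc-near (leave {p} le) = leave (enc-gap p le)
  enc-near (keep r) = keep (enc-near r)

  dec-near : ∀ {m n l l′} → n ℕ.* suc b ℕ.≤ m → Near id m l l′ → Near proj₁ n (map dec l) (map dec l′)
  dec-near le stay = stay
  dec-near le (leave {g} p) = leave (dec-gap g (ℕₚ.≤-trans le p))
  dec-near le (keep r) = keep (dec-near le r)

  encode : Point → List ℕ
  encode (w , l) = index w ∷ map enc l

  -- The first entry selects the initial state when it is below size; larger first entries must agree
  -- with the value at [], to which they converge.
  decode : List ℕ → Point
  decode [] = state 0 , []
  decode (g ∷ l) with g ℕ.<? size
  ... | yes _ = state g , map dec l
  ... | no _  = state 0 , dec (g ℕ.∸ size) ∷ map dec l

  decode-encode : ∀ y → decode (encode y) ≡ y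
  decode-encode (w , l) with index w ℕ.<? size
  ... | yes _ = cong₂ _,_ (state-index w) (trans (sym (map-∘ l)) (trans (map-cong dec-enc l) (map-id l)))
  ... | no ¬p = contradiction (index< w) ¬p

  -- The summand `size` prevents a far first entry from selecting a state, and `n * suc b` leaves a
  -- wait of at least `n` after division by `suc b`.
  decode-near : ∀ {n l l′} → Near id (n ℕ.* suc b ℕ.+ size) l l′ → decode l ≈[ n ] decode l′
  decode-near stay = refl , stay
  decode-near {n} (leave {g} p) with g ℕ.<? size
  ... | yes lt = contradiction (ℕₚ.≤-trans (ℕₚ.m≤n+m size (n ℕ.* suc b)) p) (ℕₚ.<⇒≱ lt)
  ... | no _   = refl , leave (dec-gap (g ℕ.∸ size) (ℕₚ.m+n≤o⇒m≤o∸n (n ℕ.* suc b) p))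
  decode-near {n} (keep {g} r) with g ℕ.<? size
  ... | yes _ = refl , dec-near (ℕₚ.m≤m+n (n ℕ.* suc b) size) r
  ... | no _  = refl , keep (dec-near (ℕₚ.m≤m+n (n ℕ.* suc b) size) r)

  encode-near : ∀ {n y y′} → y ≈[ n ] y′ → Near id n (encode y) (encode y′)
  encode-near (refl , r) = keep (enc-near r)

  -- Appending the entry `(n , j)` delays the extra move `j` by a wait of `n`. At the empty code the
  -- offset `size` keeps the new first entry from being read as an initial state.
  decode-move : ∀ l n j → ∃ λ l′ → Near id n l l′ × limit (decode l′) ≡ move j (limit (decode l))
  decode-move [] n j = size ℕ.+ enc (n , j) ∷ [] , leave (ℕₚ.≤-trans (enc-gap (n , j) ℕₚ.≤-refl) (ℕₚ.m≤n+m _ size)) , lim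
    where
    lim : limit (decode (size ℕ.+ enc (n , j) ∷ [])) ≡ move j (state 0)
    lim with size ℕ.+ enc (n , j) ℕ.<? size
    ... | yes lt = contradiction (ℕₚ.m≤m+n size (enc (n , j))) (ℕₚ.<⇒≱ lt)
    ... | no _ = cong (λ p → move (proj₂ p) (state 0)) (trans (cong dec (ℕₚ.m+n∸m≡n size (enc (n , j)))) (dec-enc (n , j)))
  decode-move (g ∷ l) n j = g ∷ l ++ enc (n , j) ∷ [] , keep (extend l) , lim
    where
    extend : ∀ l → Near id n l (l ++ enc (n , j) ∷ [])
    extend []      = leave (enc-gap (n , j) ℕₚ.≤-refl)
    extend (x ∷ l) = keep (extend l)
    fin : ∀ w l → final w (map dec (l ++ enc (n , j) ∷ [])) ≡ move j (final w (map dec l))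
    fin w l = trans (cong (final w) (trans (map-++ dec l _) (cong (λ p → map dec l ++ p ∷ []) (dec-enc (n , j)))))
            (final-++ w (map dec l) n j)
    lim : limit (decode (g ∷ l ++ enc (n , j) ∷ [])) ≡ move j (limit (decode (g ∷ l)))
    lim with g ℕ.<? size
    ... | yes _ = fin (state g) l
    ... | no _  = fin (move (proj₂ (dec (g ℕ.∸ size))) (state 0)) l

  -- Transfer to ℚ

  abstract

    ρ : ℚ → Point
    ρ x = decode (code x)

    -- `decode` has the section `encode` but is not injective, so `f` is not a conjugate of `shift`;
    -- it is built so that `ρ` carries orbits of `f` to orbits of `shift`.
    f : ℚ → ℚ
    f x = point-of (encode (shift (ρ x)))

    at : Point → ℚ
    at y = point-of (encode y)

    ρ-at : ∀ y → ρ (at y) ≡ y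
    ρ-at y = trans (cong decode (code-point (encode y))) (decode-encode y)

    ρ-f : ∀ x → ρ (f x) ≡ shift (ρ x)
    ρ-f x = ρ-at (shift (ρ x))

    ρ-near : ∀ x n → Nearby x (λ y → ρ x ≈[ n ] ρ y)
    ρ-near x n = Nearby-map decode-near (code-continuous x (n ℕ.* suc b ℕ.+ size))

    f-continuous : Continuous f
    f-continuous x ε 0<ε = go (point-continuous (encode (shift (ρ x))) 0<ε)
      where
      Close : ℚ → Set
      Close y = ∣ f y - f x ∣ ℚ.< ε
      go : (∃ λ n → ∀ {l} → Near id n (encode (shift (ρ x))) l → ∣ point-of l - f x ∣ ℚ.< ε) → Nearby x Close
      go (n , h) = Nearby-map {x} {λ y → ρ x ≈[ suc n ] ρ y} {Close}
        (λ {y} r → h (encode-near {y = shift (ρ x)} {shift (ρ y)} (shift-near {y = ρ x} {ρ y} r))) (ρ-near x (suc n))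

    ρ-dense : ∀ x j {ε} → 0ℚ ℚ.< ε → ∃ λ y → ∣ y - x ∣ ℚ.< ε × limit (ρ y) ≡ move j (limit (ρ x))
    ρ-dense x j {ε} 0<ε with point-continuous (code x) 0<ε
    ... | n , h with decode-move (code x) n j
    ... | l , r , e = point-of l , subst (λ z → ∣ point-of l - z ∣ ℚ.< ε) (point-code x) (h r) ,
                      trans (cong (limit ∘ decode) (code-point l)) e

  limits : ℚ → W
  limits x = limit (ρ x)

  limits-S : ∀ x → S (limits x) (limits (f x))
  limits-S x = subst (λ y → S (limits x) (limit y)) (sym (ρ-f x)) (S-limit (ρ x))

  limits-open : ∀ {P : W → Set} → (∀ {w} j → P w → P (move j w)) → ∀ x → P (limits x) → Nearby x (P ∘ limits)
  limits-open {P} mono x p = Nearby-map (λ r → limit-near {P} mono r p) (ρ-near x 0)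

  limits-onto : ∀ w → ∃ λ x → limits x ≡ w
  limits-onto w = at (w , []) , cong limit (ρ-at (w , []))

  ρ-iter : ∀ n x → ρ (iter f n x) ≡ fold (ρ x) shift n
  ρ-iter zero    x = refl
  ρ-iter (suc n) x = trans (ρ-f (iter f n x)) (cong shift (ρ-iter n x))

  limits-iter : ∀ x → ∃ λ n → ∃ λ v → ∀ m → limits (iter f (m ℕ.+ n) x) ≡ fold v default m
  limits-iter x with settles _ (proj₁ (ρ x)) (proj₂ (ρ x)) ℕₚ.≤-refl
  ... | n , v , e = n , v , λ m → cong limit (trans (ρ-iter (m ℕ.+ n) x) (orbit m))
    where
    orbit : ∀ m → fold (ρ x) shift (m ℕ.+ n) ≡ (fold v default m , [])
    orbit zero    = e
    orbit (suc m) = cong shift (orbit m)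

open import Data.List.Membership.Propositional using (_∈_; _∉_; find; lose)
open import Data.List.Membership.Propositional.Properties
import Data.List.Membership.DecPropositional as DecMembership
open import Data.List.Properties using (length-filter)
open import Data.List.Relation.Binary.Sublist.Propositional as Sub using ([]; _∷_; _∷ʳ_)
import Data.List.Relation.Binary.Sublist.Propositional.Properties as Subₚ
open import Data.List.Relation.Unary.All as All using (All; []; _∷_; all?)
open import Data.List.Relation.Unary.All.Properties using (¬All⇒Any¬)
open import Data.List.Relation.Unary.Any as Any using (Any; here; there; any?)
import Data.List.Relation.Unary.Any.Properties as Anyₚ
open import Data.Rational using (_-_; ∣_∣)
open import Relation.Unary using (Decidable; _⊆_)
open import Defs
open Rationals using (Nearby; Nearby-map; ∣x-x∣<ε)
open import Data.Nat using (_≤_; _<_; z≤n; s≤s)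

-- Contexts and decidable equality of formulas

Ctx : Set₁
Ctx = Formula → Set

private variable
  Γ Δ : Ctx
  φ ψ χ θ C : Formula

-- Comparing head symbols first leaves only the diagonal cases of equality.
tag : Formula → ℕ
tag ⊥′       = 0
tag (var _)  = 1
tag (_ ∧′ _) = 2
tag (_ ∨′ _) = 3
tag (_ ⇒ _)  = 4
tag (○ _)    = 5
tag (◇ _)    = 6
tag (A _)    = 7

_≟_ : (φ ψ : Formula) → Dec (φ ≡ ψ)
≟-tag : (φ ψ : Formula) → tag φ ≡ tag ψ → Dec (φ ≡ ψ)

φ ≟ ψ with tag φ ℕ.≟ tag ψ
... | yes p = ≟-tag φ ψ p
... | no ¬p = no (¬p ∘ cong tag)

≟-tag ⊥′ ⊥′ _ = yes refl
≟-tag (var p) (var q) _ with p ℕ.≟ q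
... | yes refl = yes refl
... | no ¬p = no λ { refl → ¬p refl }
≟-tag (a ∧′ b) (c ∧′ d) _ with a ≟ c | b ≟ d
... | yes refl | yes refl = yes refl
... | no ¬p | _ = no λ { refl → ¬p refl }
... | _ | no ¬p = no λ { refl → ¬p refl }
≟-tag (a ∨′ b) (c ∨′ d) _ with a ≟ c | b ≟ d
... | yes refl | yes refl = yes refl
... | no ¬p | _ = no λ { refl → ¬p refl }
... | _ | no ¬p = no λ { refl → ¬p refl }
≟-tag (a ⇒ b) (c ⇒ d) _ with a ≟ c | b ≟ d
... | yes refl | yes refl = yes refl
... | no ¬p | _ = no λ { refl → ¬p refl }
... | _ | no ¬p = no λ { refl → ¬p refl }
≟-tag (○ a) (○ c) _ with a ≟ c
... | yes refl = yes refl
... | no ¬p = no λ { refl → ¬p refl }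
≟-tag (◇ a) (◇ c) _ with a ≟ c
... | yes refl = yes refl
... | no ¬p = no λ { refl → ¬p refl }
≟-tag (A a) (A c) _ with a ≟ c
... | yes refl = yes refl
... | no ¬p = no λ { refl → ¬p refl }

-- Derivations from hypotheses

infixl 4 _▸_
infix 3 _⊩_

-- Only modus ponens acts on hypotheses, all other rules stay inside `thm`; hence the deduction
-- theorem holds. Contexts are predicates so that `λ x → Δ ⊩ ○ x` can be one.
data _⊩_ (Γ : Ctx) : Formula → Set where
  hyp : ∀ {φ} → Γ φ → Γ ⊩ φ
  thm : ∀ {φ} → ⊢ φ → Γ ⊩ φ
  app : ∀ {φ ψ} → Γ ⊩ φ ⇒ ψ → Γ ⊩ φ → Γ ⊩ ψ

_▸_ : Ctx → Formula → Ctx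
(Γ ▸ φ) χ = Γ χ ⊎ χ ≡ φ

_⊑_ : Ctx → Ctx → Set
Γ ⊑ Δ = ∀ {χ} → Γ χ → Δ χ

bind : (∀ {χ} → Γ χ → Δ ⊩ χ) → Γ ⊩ φ → Δ ⊩ φ
bind h (hyp x)   = h x
bind h (thm x)   = thm x
bind h (app d e) = app (bind h d) (bind h e)

weaken : Γ ⊑ Δ → Γ ⊩ φ → Δ ⊩ φ
weaken h = bind (hyp ∘ h)

weaken₁ : Γ ⊩ φ → Γ ▸ ψ ⊩ φ
weaken₁ = weaken inj₁

new : Γ ▸ φ ⊩ φ
new = hyp (inj₂ refl)

ded : Γ ▸ φ ⊩ ψ → Γ ⊩ φ ⇒ ψ
ded (hyp (inj₁ x))        = app (thm k) (hyp x)
ded {φ = φ} (hyp (inj₂ refl)) = thm (mp (mp s k) (k {ψ = φ}))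
ded (thm x)               = app (thm k) (thm x)
ded (app d e)             = app (app (thm s) (ded d)) (ded e)

closed : (λ _ → ⊥) ⊩ φ → ⊢ φ
closed (thm x)   = x
closed (app d e) = mp (closed d) (closed e)

infixr 5 _⨾_
_⨾_ : Γ ⊩ φ ⇒ ψ → Γ ⊩ ψ ⇒ χ → Γ ⊩ φ ⇒ χ
d ⨾ e = ded (app (weaken₁ e) (app (weaken₁ d) new))

∨E : Γ ⊩ φ ∨′ ψ → Γ ⊩ φ ⇒ χ → Γ ⊩ ψ ⇒ χ → Γ ⊩ χ
∨E d e f = app (app (app (thm ∨e) e) f) d

-- Excluded middle relative to the goal: the first derivation proves `θ ⇒ χ`, which is exactly the
-- hypothesis of the second.
cut : Γ ▸ θ ⊩ χ → Γ ▸ (θ ⇒ χ) ⊩ χ → Γ ⊩ χ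
cut d e = app (ded e) (ded d)

○-lift : (∀ {χ} → Γ χ → Δ ⊩ ○ χ) → Γ ⊩ φ → Δ ⊩ ○ φ
○-lift h (hyp x)   = h x
○-lift h (thm x)   = thm (○nec x)
○-lift h (app d e) = app (app (thm ○⇒) (○-lift h d)) (○-lift h e)

A-lift : (∀ {χ} → Γ χ → Δ ⊩ A χ) → Γ ⊩ φ → Δ ⊩ A φ
A-lift h (hyp x)   = h x
A-lift h (thm x)   = thm (Anec x)
A-lift h (app d e) = app (app (thm AK) (A-lift h d)) (A-lift h e)

⋁ ⋀ : List Formula → Formula
⋁ []       = ⊥′
⋁ (x ∷ xs) = x ∨′ ⋁ xs
⋀ []       = ⊥′ ⇒ ⊥′
⋀ (x ∷ xs) = x ∧′ ⋀ xs

⋁I : ∀ {xs} → φ ∈ xs → Γ ⊩ φ ⇒ ⋁ xs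
⋁I (here refl) = thm ∨i₁
⋁I (there i)   = ⋁I i ⨾ thm ∨i₂

⋁E : ∀ xs → (∀ {x} → x ∈ xs → Γ ⊩ x ⇒ χ) → Γ ⊩ ⋁ xs ⇒ χ
⋁E []       h = thm efq
⋁E (x ∷ xs) h = app (app (thm ∨e) (h (here refl))) (⋁E xs (h ∘ there))

⋀I : ∀ xs → (∀ {x} → x ∈ xs → Γ ⊩ x) → Γ ⊩ ⋀ xs
⋀I []       h = thm efq
⋀I (x ∷ xs) h = app (app (thm ∧i) (h (here refl))) (⋀I xs (h ∘ there))

⋀E : ∀ {xs} → φ ∈ xs → Γ ⊩ ⋀ xs ⇒ φ
⋀E (here refl) = thm ∧e₁
⋀E (there i)   = thm ∧e₂ ⨾ ⋀E i

○-mono : (λ _ → ⊥) ⊩ φ ⇒ ψ → Γ ⊩ ○ φ ⇒ ○ ψ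
○-mono d = app (thm ○⇒) (thm (○nec (closed d)))

○⋁E : ∀ xs → (∀ {x} → x ∈ xs → Γ ⊩ ○ x ⇒ χ) → Γ ⊩ ○ (⋁ xs) ⇒ χ
○⋁E []       h = thm ○⊥ ⨾ thm efq
○⋁E (x ∷ xs) h = thm ○∨ ⨾ app (app (thm ∨e) (h (here refl))) (○⋁E xs (h ∘ there))

-- Lambek's argument: by `◇fix` the right-hand side is itself closed under `○`, so `◇ind` applies to
-- it.
◇-unfold : ⊢ ◇ φ ⇒ φ ∨′ ○ (◇ φ)
◇-unfold {φ} = closed (thm (◇mono (closed (thm ∨i₁))) ⨾ thm (◇ind (closed (○-mono (thm ◇fix) ⨾ thm ∨i₂))))

module _ {X : Set} (h : X → Formula) where

  -- It suffices to treat every splitting of `xs` into formulas that are derivable and formulas that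
  -- imply the goal. The parts stay sublists of `xs`, so finitely many labels arise.
  cuts : ∀ xs → (∀ {L R} Δ → L Sub.⊆ xs → R Sub.⊆ xs → (∀ {x} → x ∈ xs → x ∈ L ⊎ x ∈ R) → Γ ⊑ Δ →
         (∀ {x} → x ∈ L → Δ ⊩ h x) → (∀ {x} → x ∈ R → Δ ⊩ h x ⇒ χ) → Δ ⊩ χ) → Γ ⊩ χ
  cuts [] H = H _ [] [] (λ ()) id (λ ()) (λ ())
  cuts (x ∷ xs) H = cuts xs λ Δ l r c e p n → cut
    (H _ (refl ∷ l) (x ∷ʳ r) (λ { (here q) → inj₁ (here q) ; (there i) → Sum.map₁ there (c i) }) (inj₁ ∘ e)
      (λ { (here refl) → new ; (there i) → weaken₁ (p i) }) (weaken₁ ∘ n))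
    (H _ (x ∷ʳ l) (refl ∷ r) (λ { (here q) → inj₂ (here q) ; (there i) → Sum.map₂ there (c i) }) (inj₁ ∘ e)
      (weaken₁ ∘ p) (λ { (here refl) → new ; (there i) → weaken₁ (n i) }))

-- Round-robin scheduling

cycle : ∀ {m} → Fin (suc m) → Fin (suc m)
cycle {m} zero    = fromℕ m
cycle     (suc i) = inject₁ i

data Cycles {m : ℕ} : Fin (suc m) → Fin (suc m) → Set where
  done : ∀ {t} → Cycles t t
  turn : ∀ {t u} → Cycles (cycle t) u → Cycles t u

Cycles-trans : ∀ {m} {t u v : Fin (suc m)} → Cycles t u → Cycles u v → Cycles t v
Cycles-trans done     q = q
Cycles-trans (turn p) q = turn (Cycles-trans p q)

cycle-down : ∀ {m} d (t u : Fin (suc m)) → toℕ t ≡ toℕ u ℕ.+ d → Cycles t u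
cycle-down zero t u e with Finₚ.toℕ-injective (trans e (ℕₚ.+-identityʳ (toℕ u)))
... | refl = done
cycle-down (suc d) zero    u e = contradiction (trans e (ℕₚ.+-suc (toℕ u) d)) λ ()
cycle-down (suc d) (suc i) u e = turn (cycle-down d (inject₁ i) u
  (trans (Finₚ.toℕ-inject₁ i) (ℕₚ.suc-injective (trans e (ℕₚ.+-suc (toℕ u) d)))))

-- Down from `t` to zero, one wrap to the largest index, then down to `u`.
cycles : ∀ {m} (t u : Fin (suc m)) → Cycles t u
cycles {m} t u = Cycles-trans (cycle-down (toℕ t) t zero refl) (turn (cycle-down (m ℕ.∸ toℕ u) (fromℕ m) u
  (trans (Finₚ.toℕ-fromℕ m) (sym (ℕₚ.m+[n∸m]≡n (ℕₚ.≤-pred (Finₚ.toℕ<n u)))))))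

-- Finite lists

module _ {X : Set} where

  -- The constructive substitute for a classical case distinction; `B` will be a derivation or a
  -- counterexample.
  all-or : ∀ {P : X → Set} {B : Set} xs → (∀ {x} → x ∈ xs → B ⊎ P x) → B ⊎ (∀ {x} → x ∈ xs → P x)
  all-or [] h = inj₂ λ ()
  all-or (x ∷ xs) h with h (here refl) | all-or xs (h ∘ there)
  ... | inj₁ b | _ = inj₁ b
  ... | _ | inj₁ b = inj₁ b
  ... | inj₂ p | inj₂ q = inj₂ λ { (here refl) → p ; (there i) → q i }

  sublists : List X → List (List X)
  sublists []       = [] ∷ []
  sublists (x ∷ xs) = map (x ∷_) (sublists xs) ++ sublists xs

  ∈-sublists⁺ : ∀ {xs ys} → xs Sub.⊆ ys → xs ∈ sublists ys
  ∈-sublists⁺ []         = here refl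
  ∈-sublists⁺ (y ∷ʳ τ)   = ∈-++⁺ʳ _ (∈-sublists⁺ τ)
  ∈-sublists⁺ (refl ∷ τ) = ∈-++⁺ˡ (∈-map⁺ _ (∈-sublists⁺ τ))

  ∈-sublists⁻ : ∀ {xs} ys → xs ∈ sublists ys → xs Sub.⊆ ys
  ∈-sublists⁻ [] (here refl) = []
  ∈-sublists⁻ (y ∷ ys) i with ∈-++⁻ (map (y ∷_) (sublists ys)) i
  ... | inj₂ j = y ∷ʳ ∈-sublists⁻ ys j
  ... | inj₁ j with ∈-map⁻ _ j
  ... | _ , l , refl = refl ∷ ∈-sublists⁻ ys l

  module _ {P Q : X → Set} (P? : Decidable P) (Q? : Decidable Q) (sub : P ⊆ Q) where

    length-filter-mono : ∀ xs → length (filter P? xs) ≤ length (filter Q? xs)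
    length-filter-mono [] = z≤n
    length-filter-mono (x ∷ xs) with P? x | Q? x
    ... | yes p | yes q = s≤s (length-filter-mono xs)
    ... | yes p | no ¬q = contradiction (sub p) ¬q
    ... | no _  | yes _ = ℕₚ.m≤n⇒m≤1+n (length-filter-mono xs)
    ... | no _  | no _  = length-filter-mono xs

    length-filter-mono-< : ∀ {x xs} → x ∈ xs → Q x → ¬ P x → length (filter P? xs) < length (filter Q? xs)
    length-filter-mono-< {x} {_ ∷ xs} (here refl) qx ¬px with P? x | Q? x
    ... | yes p | _ = contradiction p ¬px
    ... | no _ | no ¬q = contradiction qx ¬q
    ... | no _ | yes _ = s≤s (length-filter-mono xs)
    length-filter-mono-< {x} {y ∷ xs} (there i) qx ¬px with P? y | Q? y
    ... | yes p | yes q = s≤s (length-filter-mono-< i qx ¬px)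
    ... | yes p | no ¬q = contradiction (sub p) ¬q
    ... | no _  | yes _ = ℕₚ.m≤n⇒m≤1+n (length-filter-mono-< i qx ¬px)
    ... | no _  | no _  = length-filter-mono-< i qx ¬px

open DecMembership _≟_ using (_∈?_)

mem : Formula → List Formula → Bool
mem φ T = does (φ ∈? T)

mem-true : ∀ {T} → φ ∈ T → mem φ T ≡ true
mem-true {φ} {T} i with φ ∈? T
... | yes _ = refl
... | no ¬i = contradiction i ¬i

mem-false : ∀ {T} → φ ∉ T → mem φ T ≡ false
mem-false {φ} {T} i with φ ∈? T
... | yes j = contradiction j i
... | no _ = refl

true-mem : ∀ {T} → mem φ T ≡ true → φ ∈ T
true-mem {φ} {T} e with φ ∈? T
... | yes i = i

-- Moments

data Moment : Set where
  node : List Formula → List Moment → Moment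

lab : Moment → List Formula
lab (node T _) = T

ch : Moment → List Moment
ch (node _ cs) = cs

data Imm : Formula → Formula → Set where
  ∧l : Imm φ (φ ∧′ ψ)
  ∧r : Imm ψ (φ ∧′ ψ)
  ∨l : Imm φ (φ ∨′ ψ)
  ∨r : Imm ψ (φ ∨′ ψ)
  ⇒l : Imm φ (φ ⇒ ψ)
  ⇒r : Imm ψ (φ ⇒ ψ)
  ○i : Imm φ (○ φ)
  ◇i : Imm φ (◇ φ)
  Ai : Imm φ (A φ)

split-∈ : ∀ {X : Set} {x : X} {xs} → x ∈ xs →
          ∃ λ ys → length xs ≡ suc (length ys) × (∀ {y} → y ∈ xs → y ≡ x ⊎ y ∈ ys) × (∀ {y} → y ∈ ys → y ∈ xs)
split-∈ {xs = x ∷ xs} (here refl) = xs , refl , (λ { (here p) → inj₁ p ; (there i) → inj₂ i }) , there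
split-∈ {xs = x ∷ xs} (there i) with split-∈ i
... | ys , eq , f , g = x ∷ ys , cong suc eq , (λ { (here p) → inj₂ (here p) ; (there j) → Sum.map₂ there (f j) }) ,
                        λ { (here p) → here p ; (there j) → there (g j) }

module Moments (F : List Formula) (F-sub : ∀ {φ ψ} → Imm φ ψ → ψ ∈ F → φ ∈ F) where

  outside : List Formula → List Formula
  outside T = filter (λ x → ¬? (x ∈? T)) F

  -- excl w says that w is not realised above the current point: no point above has exactly the
  -- formulas of lab w true and realises all children of w above it.
  excl  : Moment → Formula
  excls : List Moment → List Formula
  excl (node T cs) = ⋀ T ⇒ ⋁ (outside T ++ excls cs)
  excls []       = []
  excls (c ∷ cs) = excl c ∷ excls cs

  excls-map : ∀ cs → excls cs ≡ map excl cs
  excls-map []       = refl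
  excls-map (c ∷ cs) = cong (excl c ∷_) (excls-map cs)

  -- Labels grow strictly towards the children, so this number strictly falls along branches; it
  -- bounds the height of moments.
  def : List Formula → ℕ
  def T = length (outside T)

  def-< : ∀ {T T′ x} → (∀ {y} → y ∈ T → y ∈ T′) → x ∈ T′ → x ∉ T → x ∈ F → def T′ < def T
  def-< {T} {T′} T⊆ x∈ x∉ x∈F = length-filter-mono-< (λ x → ¬? (x ∈? T′)) (λ x → ¬? (x ∈? T)) (_∘ T⊆) x∈F x∉ (λ f → f x∈)

  def-≤ : ∀ {T T′} → (∀ {y} → y ∈ T → y ∈ T′) → def T′ ≤ def T
  def-≤ {T} {T′} T⊆ = length-filter-mono (λ x → ¬? (x ∈? T′)) (λ x → ¬? (x ∈? T)) (_∘ T⊆) F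

  Bigger : List Formula → Moment → Set
  Bigger T m = All (_∈ lab m) T × Any (_∉ T) (lab m)

  bigger? : ∀ T → Decidable (Bigger T)
  bigger? T m = all? (_∈? lab m) T ×-dec any? (λ x → ¬? (x ∈? T)) (lab m)

  -- If `a ⇒ b` is missing, a child shows the failure, or the node itself does when `a ∈ T`: the
  -- local conditions imposed on survivors then give `b ∉ T`.
  Witnessed : List Formula → List Moment → Formula → Set
  Witnessed T cs (a ⇒ b) = a ⇒ b ∈ T ⊎ a ∈ T ⊎ Any (λ c → a ∈ lab c × b ∉ lab c) cs
  Witnessed _ _ _ = ⊤

  witnessed? : ∀ T cs → Decidable (Witnessed T cs)
  witnessed? T cs (a ⇒ b) = (a ⇒ b ∈? T) ⊎-dec (a ∈? T) ⊎-dec any? (λ c → (a ∈? lab c) ×-dec ¬? (b ∈? lab c)) cs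
  witnessed? _ _ ⊥′       = yes tt
  witnessed? _ _ (var _)  = yes tt
  witnessed? _ _ (_ ∧′ _) = yes tt
  witnessed? _ _ (_ ∨′ _) = yes tt
  witnessed? _ _ (○ _)    = yes tt
  witnessed? _ _ (◇ _)    = yes tt
  witnessed? _ _ (A _)    = yes tt

  Legit : Moment → Set
  Legit m = All (Bigger (lab m)) (ch m) × All (Witnessed (lab m) (ch m)) F

  legit? : Decidable Legit
  legit? m = all? (bigger? (lab m)) (ch m) ×-dec all? (witnessed? (lab m) (ch m)) F

  at? : ∀ d → Decidable (λ m → def (lab m) ≡ d × Legit m)
  at? d m = (def (lab m) ℕ.≟ d) ×-dec legit? m

  -- Stage `suc d` adds the nodes with `d` formulas missing; their children form sublists of the
  -- earlier stage, which keeps the collection finite.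
  moments : ℕ → List Moment
  moments zero    = []
  moments (suc d) = moments d ++ filter (at? d) (cartesianProductWith node (sublists F) (sublists (moments d)))

  record Ok (m : Moment) : Set where
    field
      labels   : lab m Sub.⊆ F
      children : ch m Sub.⊆ moments (def (lab m))
      legit    : Legit m

  moments-up : ∀ {d e m} → d ≤ e → m ∈ moments d → m ∈ moments e
  moments-up d≤e i = go (ℕₚ.≤⇒≤′ d≤e) i where
    go : ∀ {d e m} → d ℕ.≤′ e → m ∈ moments d → m ∈ moments e
    go ℕ.≤′-refl i = i
    go (ℕ.≤′-step p) i = ∈-++⁺ˡ (go p i)

  moments⁺ : ∀ {m d} → Ok m → def (lab m) < d → m ∈ moments d
  moments⁺ {node T cs} ok lt = moments-up lt (∈-++⁺ʳ _ (∈-filter⁺ (at? _)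
    (∈-cartesianProductWith⁺ node (∈-sublists⁺ (Ok.labels ok)) (∈-sublists⁺ (Ok.children ok))) (refl , Ok.legit ok)))

  moments⁻ : ∀ {m} d → m ∈ moments d → Ok m × def (lab m) < d
  moments⁻ (suc d) i with ∈-++⁻ (moments d) i
  ... | inj₁ j with moments⁻ d j
  ... | ok , lt = ok , ℕₚ.m≤n⇒m≤1+n lt
  moments⁻ (suc d) i | inj₂ j with ∈-filter⁻ (at? d) {xs = cartesianProductWith node (sublists F) (sublists (moments d))} j
  ... | l , refl , leg with ∈-cartesianProductWith⁻ node (sublists F) (sublists (moments d)) l
  ... | T , cs , p , q , refl = record { labels = ∈-sublists⁻ F p ; children = ∈-sublists⁻ _ q ; legit = leg } , ℕₚ.≤-refl

  M : List Moment
  M = moments (suc (length F))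

  def≤F : ∀ T → def T ≤ length F
  def≤F T = length-filter (λ x → ¬? (x ∈? T)) F

  M⁺ : ∀ {m} → Ok m → m ∈ M
  M⁺ {m} ok = moments⁺ ok (s≤s (def≤F (lab m)))

  M⁻ : ∀ {m} → m ∈ M → Ok m
  M⁻ i = proj₁ (moments⁻ _ i)

  lab⊆F : ∀ {m} → m ∈ M → ∀ {x} → x ∈ lab m → x ∈ F
  lab⊆F i = Sub.lookup (Ok.labels (M⁻ i))

  ch⊆M : ∀ {m} → m ∈ M → ∀ {c} → c ∈ ch m → c ∈ M
  ch⊆M {m} i j = moments-up (ℕₚ.m≤n⇒m≤1+n (def≤F (lab m))) (Sub.lookup (Ok.children (M⁻ i)) j)

  bigger-moment : ∀ {T m} → m ∈ M → Bigger T m → m ∈ moments (def T)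
  bigger-moment i (sub , x) with find x
  ... | y , y∈ , y∉ = moments⁺ (M⁻ i) (def-< (All.lookup sub) y∈ y∉ (lab⊆F i y∈))

  -- Exclusion and saturated contexts

  ∈-outside : ∀ {T x} → x ∈ F → x ∉ T → x ∈ outside T
  ∈-outside {T} = ∈-filter⁺ (λ x → ¬? (x ∈? T))

  outside-∉ : ∀ {T x} → x ∈ outside T → x ∈ F × x ∉ T
  outside-∉ {T} = ∈-filter⁻ (λ x → ¬? (x ∈? T))

  ∈-excls : ∀ {c cs} → c ∈ cs → excl c ∈ excls cs
  ∈-excls {cs = cs} i = subst (_ ∈_) (sym (excls-map cs)) (∈-map⁺ excl i)

  -- Exclusion in continuation form: leaving `C` arbitrary hides the disjunction in which `excl`
  -- ends.
  excl-intro : ∀ {T cs} → (∀ {Δ C} → Γ ⊑ Δ → (∀ {x} → x ∈ T → Δ ⊩ x) → (∀ {x} → x ∈ F → x ∉ T → Δ ⊩ x ⇒ C) →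
               (∀ {c} → c ∈ cs → Δ ⊩ excl c ⇒ C) → Δ ⊩ C) → Γ ⊩ excl (node T cs)
  excl-intro {T = T} H = ded (H inj₁ (λ i → app (⋀E i) new)
    (λ x∈ x∉ → ⋁I (∈-++⁺ˡ (∈-outside x∈ x∉))) (λ i → ⋁I (∈-++⁺ʳ (outside T) (∈-excls i))))

  excl-elim : ∀ {m} → Γ ⊩ excl m → (∀ {x} → x ∈ lab m → Γ ⊩ x) → (∀ {x} → x ∈ F → x ∉ lab m → Γ ⊩ x ⇒ C) →
              (∀ {c} → c ∈ ch m → Γ ⊩ excl c ⇒ C) → Γ ⊩ C
  excl-elim {Γ} {C} {m = node T cs} d p n c = app (⋁E _ go) (app d (⋀I T p)) where
    go : ∀ {x} → x ∈ outside T ++ excls cs → Γ ⊩ x ⇒ C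
    go i with ∈-++⁻ (outside T) i
    ... | inj₁ j = let x∈ , x∉ = outside-∉ {T} j in n x∈ x∉
    ... | inj₂ j with ∈-map⁻ excl (subst (_ ∈_) (excls-map cs) j)
    ... | _ , l , refl = c l

  excl-child : ∀ {m c} → c ∈ ch m → Γ ⊩ excl c → Γ ⊩ excl m
  excl-child {m = node _ _} i d = excl-intro λ e _ _ n → app (n i) (weaken e d)

  excl-pos : ∀ {m x} → x ∈ F → x ∉ lab m → Γ ⊩ x → Γ ⊩ excl m
  excl-pos {m = node _ _} x∈ x∉ d = excl-intro λ e _ n _ → app (n x∈ x∉) (weaken e d)

  -- The context behaves like a point whose moment is exactly `u`, with `C` in the role of falsity.
  -- The field `other` is maximality of the children.
  record Real (Δ : Ctx) (C : Formula) (u : Moment) : Set where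
    field
      pos   : ∀ {x} → x ∈ lab u → Δ ⊩ x
      neg   : ∀ {x} → x ∈ F → x ∉ lab u → Δ ⊩ x ⇒ C
      child : ∀ {c} → c ∈ ch u → Δ ⊩ excl c ⇒ C
      other : ∀ {m} → m ∈ M → Bigger (lab u) m → Δ ⊩ excl m ⊎ m ∈ ch u

  real-excl : ∀ {u} → Real Δ C u → Δ ⊩ excl u → Δ ⊩ C
  real-excl r d = excl-elim d (Real.pos r) (Real.neg r) (Real.child r)

  -- The finite counterpart of Lindenbaum's lemma: cut on F fixes a label T, then cut on excl m for
  -- the moments m above T.  If some a ⇒ b ∉ T is left without witness, then b itself is provable
  -- from T and a, by induction on the number of formulas outside T.
  sat : ∀ n {X} → def X < n → (∀ {x} → x ∈ X → x ∈ F) → (∀ {x} → x ∈ X → Γ ⊩ x) →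
        (∀ {Δ u} → Γ ⊑ Δ → u ∈ M → (∀ {x} → x ∈ X → x ∈ lab u) → Real Δ C u → Δ ⊩ C) → Γ ⊩ C
  sat {Γ} {C} (suc n) {X} lt X⊆F X⊩ H = cuts id F step where
    step : ∀ {T N} Δ → T Sub.⊆ F → N Sub.⊆ F → (∀ {x} → x ∈ F → x ∈ T ⊎ x ∈ N) → Γ ⊑ Δ →
           (∀ {x} → x ∈ T → Δ ⊩ x) → (∀ {x} → x ∈ N → Δ ⊩ x ⇒ C) → Δ ⊩ C
    step {T} {N} Δ T⊆ N⊆ cov Γ⊑ T⊩ N⊩ with all? (_∈? T) X
    ... | no ¬X with find (¬All⇒Any¬ (_∈? T) _ ¬X)
    ... | x , x∈X , x∉T with cov (X⊆F x∈X)
    ... | inj₁ x∈T = contradiction x∈T x∉T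
    ... | inj₂ x∈N = app (N⊩ x∈N) (weaken Γ⊑ (X⊩ x∈X))
    step {T} {N} Δ T⊆ N⊆ cov Γ⊑ T⊩ N⊩ | yes X⊆T = cuts excl (moments (def T)) step′ where
      step′ : ∀ {P Q} Δ′ → P Sub.⊆ moments (def T) → Q Sub.⊆ moments (def T) →
              (∀ {m} → m ∈ moments (def T) → m ∈ P ⊎ m ∈ Q) → Δ ⊑ Δ′ →
              (∀ {m} → m ∈ P → Δ′ ⊩ excl m) → (∀ {m} → m ∈ Q → Δ′ ⊩ excl m ⇒ C) → Δ′ ⊩ C
      step′ {P} {Q} Δ′ P⊆ Q⊆ covM Δ⊑ P⊩ Q⊩ with all? (witnessed? T (filter (bigger? T) Q)) F
      ... | yes wit = H (Δ⊑ ∘ Γ⊑) (M⁺ ok) (All.lookup X⊆T) record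
        { pos   = weaken Δ⊑ ∘ T⊩
        ; neg   = λ x∈ x∉ → [ (λ x∈T → contradiction x∈T x∉) , (λ x∈N → weaken Δ⊑ (N⊩ x∈N)) ] (cov x∈)
        ; child = λ c∈ → Q⊩ (proj₁ (∈-filter⁻ (bigger? T) c∈))
        ; other = λ m∈ big → [ inj₁ ∘ P⊩ , (λ m∈Q → inj₂ (∈-filter⁺ (bigger? T) m∈Q big)) ] (covM (bigger-moment m∈ big))
        }
        where
        ok : Ok (node T (filter (bigger? T) Q))
        ok = record { labels = T⊆ ; children = Sub.⊆-trans (Subₚ.filter-⊆ (bigger? T) Q) Q⊆
                    ; legit = All.tabulate (λ i → proj₂ (∈-filter⁻ (bigger? T) {xs = Q} i)) , wit }
      ... | no ¬wit with find (¬All⇒Any¬ (witnessed? T (filter (bigger? T) Q)) _ ¬wit)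
      ... | ⊥′ , _ , f = contradiction tt f
      ... | var _ , _ , f = contradiction tt f
      ... | _ ∧′ _ , _ , f = contradiction tt f
      ... | _ ∨′ _ , _ , f = contradiction tt f
      ... | ○ _ , _ , f = contradiction tt f
      ... | ◇ _ , _ , f = contradiction tt f
      ... | A _ , _ , f = contradiction tt f
      ... | a ⇒ b , i , f with cov i
      ... | inj₁ i∈T = contradiction (inj₁ i∈T) f
      ... | inj₂ i∈N = app (weaken Δ⊑ (N⊩ i∈N)) (ded (sat n {a ∷ T} def<n aT⊆F aT⊩ H′)) where
        def<n : def (a ∷ T) < n
        def<n = ℕₚ.<-≤-trans (def-< there (here refl) (f ∘ inj₂ ∘ inj₁) (F-sub ⇒l i))
                             (ℕₚ.≤-trans (def-≤ (All.lookup X⊆T)) (ℕₚ.≤-pred lt))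
        aT⊆F : ∀ {x} → x ∈ a ∷ T → x ∈ F
        aT⊆F (here refl) = F-sub ⇒l i
        aT⊆F (there j)   = Sub.lookup T⊆ j
        aT⊩ : ∀ {x} → x ∈ a ∷ T → Δ′ ▸ a ⊩ x
        aT⊩ (here refl) = new
        aT⊩ (there j)   = weaken (inj₁ ∘ Δ⊑) (T⊩ j)
        H′ : ∀ {Δ″ u} → (Δ′ ▸ a) ⊑ Δ″ → u ∈ M → (∀ {x} → x ∈ a ∷ T → x ∈ lab u) → Real Δ″ b u → Δ″ ⊩ b
        H′ {u = u} Δ′⊑ u∈ aT⊆ r with b ∈? lab u
        ... | yes b∈ = Real.pos r b∈
        -- Now `u` lies above `T`, so it is excluded or is a child kept from `Q`; as a child it
        -- would be the missing witness for `a ⇒ b`.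
        ... | no b∉ with All.tabulate (aT⊆ ∘ there) , lose (aT⊆ (here refl)) (f ∘ inj₂ ∘ inj₁)
        ... | big with covM (bigger-moment u∈ big)
        ... | inj₁ u∈P = real-excl r (weaken (Δ′⊑ ∘ inj₁) (P⊩ u∈P))
        ... | inj₂ u∈Q = contradiction (inj₂ (inj₂ (lose (∈-filter⁺ (bigger? T) u∈Q big) (aT⊆ (here refl) , b∉)))) f

  saturate : (∀ {Δ u} → Γ ⊑ Δ → u ∈ M → Real Δ C u → Δ ⊩ C) → Γ ⊩ C
  saturate H = sat (suc (def [])) ℕₚ.≤-refl (λ ()) (λ ()) (λ e i _ → H e i)

  -- Saturate with `ψ` itself as the goal: at a saturated `u` either `ψ` is in the label or the
  -- exclusion of `u` yields the goal.
  prove-by-excl : ψ ∈ F → (∀ {u} → u ∈ M → ψ ∉ lab u → Γ ⊩ excl u) → Γ ⊩ ψ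
  prove-by-excl {ψ} {Γ} ψ∈ H = saturate go where
    go : ∀ {Δ u} → Γ ⊑ Δ → u ∈ M → Real Δ ψ u → Δ ⊩ ψ
    go {u = u} e i r with ψ ∈? lab u
    ... | yes j = Real.pos r j
    ... | no ¬j = real-excl r (weaken e (H i ¬j))

  -- The successor relation

  SensAt : List Formula → List Formula → Formula → Set
  SensAt T T′ (○ ψ) = mem (○ ψ) T ≡ mem ψ T′
  SensAt T T′ (◇ ψ) = mem (◇ ψ) T ≡ mem ψ T ∨ mem (◇ ψ) T′
  SensAt _ _ _      = ⊤

  sensAt? : ∀ T T′ → Decidable (SensAt T T′)
  sensAt? T T′ (○ _)    = _ Bool.≟ _
  sensAt? T T′ (◇ _)    = _ Bool.≟ _
  sensAt? _ _ ⊥′       = yes tt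
  sensAt? _ _ (var _)  = yes tt
  sensAt? _ _ (_ ∧′ _) = yes tt
  sensAt? _ _ (_ ∨′ _) = yes tt
  sensAt? _ _ (_ ⇒ _)  = yes tt
  sensAt? _ _ (A _)    = yes tt

  -- The successor relation on moments.  Every child of w must have a successor at v or above it, so
  -- that S is forward confluent.
  S  : Moment → Moment → Set
  Ss : List Moment → Moment → Set
  S (node T cs) v = All (SensAt T (lab v)) F × Ss cs v
  Ss [] v       = ⊤
  Ss (c ∷ cs) v = (S c v ⊎ Any (S c) (ch v)) × Ss cs v

  S?  : ∀ w v → Dec (S w v)
  Ss? : ∀ cs v → Dec (Ss cs v)
  S? (node T cs) v = all? (sensAt? T (lab v)) F ×-dec Ss? cs v
  Ss? [] v       = yes tt
  Ss? (c ∷ cs) v = (S? c v ⊎-dec any? (S? c) (ch v)) ×-dec Ss? cs v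

  S-sens : ∀ {w v} → S w v → φ ∈ F → SensAt (lab w) (lab v) φ
  S-sens {w = node _ _} (h , _) i = All.lookup h i

  Ss-lookup : ∀ {cs c v} → Ss cs v → c ∈ cs → S c v ⊎ Any (S c) (ch v)
  Ss-lookup (h , _) (here refl) = h
  Ss-lookup (_ , h) (there i)   = Ss-lookup h i

  S-child : ∀ {w v c} → S w v → c ∈ ch w → S c v ⊎ Any (S c) (ch v)
  S-child {w = node _ _} (_ , h) i = Ss-lookup h i

  Ss-tabulate : ∀ cs {v} → (∀ {c} → c ∈ cs → S c v ⊎ Any (S c) (ch v)) → Ss cs v
  Ss-tabulate []       h = tt
  Ss-tabulate (c ∷ cs) h = h (here refl) , Ss-tabulate cs (h ∘ there)

  mem-cong : ∀ {T T′} → (∀ {x} → x ∈ T → x ∈ T′) → (∀ {x} → x ∈ T′ → x ∈ T) → mem φ T ≡ mem φ T′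
  mem-cong {φ} {T} {T′} f g with φ ∈? T
  ... | yes i = sym (mem-true (f i))
  ... | no ¬i = sym (mem-false (¬i ∘ g))

  sensAt-cong : ∀ {T T′ T″} φ → (∀ {ψ} → mem ψ T′ ≡ mem ψ T″) → SensAt T T′ φ → SensAt T T″ φ
  sensAt-cong (○ _)    e h = trans h e
  sensAt-cong (◇ _)    e h = trans h (cong (_ ∨_) e)
  sensAt-cong ⊥′       e h = tt
  sensAt-cong (var _)  e h = tt
  sensAt-cong (_ ∧′ _) e h = tt
  sensAt-cong (_ ∨′ _) e h = tt
  sensAt-cong (_ ⇒ _)  e h = tt
  sensAt-cong (A _)    e h = tt

  module _ {v u : Moment} (e : ∀ {ψ} → mem ψ (lab v) ≡ mem ψ (lab u)) (kids : ∀ {c} → c ∈ ch v → c ∈ ch u) where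

    S-cong  : ∀ w → S w v → S w u
    Ss-cong : ∀ cs → Ss cs v → Ss cs u
    S-cong (node T cs) (h , hs) = All.map (sensAt-cong _ e) h , Ss-cong cs hs
    Ss-cong [] _ = tt
    Ss-cong (c ∷ cs) (inj₁ h , hs) = inj₁ (S-cong c h) , Ss-cong cs hs
    Ss-cong (c ∷ cs) (inj₂ h , hs) with find h
    ... | d , d∈ , Scd = inj₂ (lose (kids d∈) Scd) , Ss-cong cs hs

  -- Exclusion carried back by one step

  succs : Moment → List Moment
  succs c = filter (S? c) M

  next : Formula → List Formula
  next (○ ψ) = ψ ∷ []
  next (◇ ψ) = ◇ ψ ∷ []
  next _     = []

  next-elim : ∀ y {x} → x ∈ next y → Γ ⊩ ○ x ⇒ y
  next-elim (○ ψ) (here refl) = ded new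
  next-elim (◇ ψ) (here refl) = thm ∨i₂ ⨾ thm ◇fix

  module _ {T : List Formula} {cs : List Moment} where

    -- If one of these formulas holds at the next point, then node T cs is excluded now.
    next-refuted : List Formula
    next-refuted = concatMap next (outside T) ++ map (λ c → ⋀ (map excl (succs c))) cs

    module _ {Δ : Ctx}
             (pos◇ : ∀ {ψ} → ◇ ψ ∈ F → ◇ ψ ∈ T → ψ ∉ T → Δ ⊩ ○ (◇ ψ))
             (neg◇ : ∀ {ψ} → ◇ ψ ∈ F → ◇ ψ ∉ T → ψ ∉ T)
             (pos : ∀ {x} → x ∈ T → Δ ⊩ x)
             (cs⊆M : ∀ {c} → c ∈ cs → c ∈ M)
             (H : ∀ {v} → v ∈ M → S (node T cs) v → Δ ⊩ ○ (excl v)) where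

      -- The context describes the next point. A saturated `u` there may violate a condition on `○`
      -- or `◇`, or leave a child without successor, and then a disjunct holds; otherwise it is a
      -- successor of `node T cs` and excluded by `H`.
      next-refutable : (λ x → Δ ⊩ ○ x) ⊩ ⋁ next-refuted
      next-refutable = saturate go where
        D = ⋁ next-refuted

        refuted : ∀ {x y} → y ∈ F → y ∉ T → x ∈ next y → Γ ⊩ x ⇒ D
        refuted i j l = ⋁I (∈-++⁺ˡ (∈-concatMap⁺ next (lose (∈-outside i j) l)))

        go : ∀ {Δ′ u} → (λ x → Δ ⊩ ○ x) ⊑ Δ′ → u ∈ M → Real Δ′ D u → Δ′ ⊩ D
        go {Δ′} {u} e u∈ r = finish (all-or F sens) (all-or cs kid)
          where
          sens : ∀ {x} → x ∈ F → Δ′ ⊩ D ⊎ SensAt T (lab u) x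
          sens {○ ψ} i with ○ ψ ∈? T | ψ ∈? lab u
          ... | yes p | yes q = inj₂ refl
          ... | yes p | no ¬q = inj₁ (app (Real.neg r (F-sub ○i i) ¬q) (hyp (e (pos p))))
          ... | no ¬p | yes q = inj₁ (app (refuted i ¬p (here refl)) (Real.pos r q))
          ... | no ¬p | no ¬q = inj₂ refl
          sens {◇ ψ} i with ◇ ψ ∈? T | ψ ∈? T | ◇ ψ ∈? lab u
          ... | yes p | yes q | _     = inj₂ refl
          ... | yes p | no ¬q | yes l = inj₂ refl
          ... | yes p | no ¬q | no ¬l = inj₁ (app (Real.neg r i ¬l) (hyp (e (pos◇ i p ¬q))))
          ... | no ¬p | yes q | _     = contradiction q (neg◇ i ¬p)
          ... | no ¬p | no ¬q | yes l = inj₁ (app (refuted i ¬p (here refl)) (Real.pos r l))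
          ... | no ¬p | no ¬q | no ¬l = inj₂ refl
          sens {⊥′}     _ = inj₂ tt
          sens {var _}  _ = inj₂ tt
          sens {_ ∧′ _} _ = inj₂ tt
          sens {_ ∨′ _} _ = inj₂ tt
          sens {_ ⇒ _}  _ = inj₂ tt
          sens {A _}    _ = inj₂ tt

          realised : ∀ {c v} → v ∈ M → S c v → (S c u ⊎ Any (S c) (ch u)) ⊎ Δ′ ⊩ excl v
          realised {c} {v} v∈ Scv with all? (_∈? lab v) (lab u)
          ... | no ¬sub = let x , x∈ , x∉ = find (¬All⇒Any¬ (_∈? lab v) _ ¬sub)
                          in inj₂ (excl-pos (lab⊆F u∈ x∈) x∉ (Real.pos r x∈))
          ... | yes sub with any? (λ x → ¬? (x ∈? lab u)) (lab v)
          ... | yes big = [ inj₂ , (λ v∈u → inj₁ (inj₂ (lose v∈u Scv))) ] (Real.other r v∈ (sub , big))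
          -- With equal labels, some child of `v` is excluded, and so is `v`, or all of them are
          -- children of `u`; then `S c v` passes to `u`, because more children only help the second
          -- argument.
          ... | no ¬big = [ inj₂ , same ] (all-or (ch v) λ d∈ → Sum.map₁ (excl-child d∈)
                  (Real.other r (ch⊆M v∈ d∈) (bigger d∈)))
            where
            v⊆u : ∀ {x} → x ∈ lab v → x ∈ lab u
            v⊆u {x} x∈ with x ∈? lab u
            ... | yes i = i
            ... | no ¬i = contradiction (lose x∈ ¬i) ¬big
            same : (∀ {d} → d ∈ ch v → d ∈ ch u) → (S c u ⊎ Any (S c) (ch u)) ⊎ Δ′ ⊩ excl v
            same kids = inj₁ (inj₁ (S-cong {v} {u} (mem-cong v⊆u (All.lookup sub)) kids c Scv))
            bigger : ∀ {d} → d ∈ ch v → Bigger (lab u) d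
            bigger d∈ = let lb , b = All.lookup (proj₁ (Ok.legit (M⁻ v∈))) d∈ ; x , x∈ , x∉ = find b
                        in All.tabulate (λ i → All.lookup lb (All.lookup sub i)) , lose x∈ (x∉ ∘ All.lookup sub)

          kid : ∀ {c} → c ∈ cs → Δ′ ⊩ D ⊎ (S c u ⊎ Any (S c) (ch u))
          kid {c} c∈ with all-or (succs c) (λ v∈ → let v∈M , Scv = ∈-filter⁻ (S? c) v∈ in realised v∈M Scv)
          ... | inj₁ h = inj₂ h
          ... | inj₂ h = inj₁ (app (⋁I (∈-++⁺ʳ _ (∈-map⁺ _ c∈))) (⋀I _ λ i → let v , v∈ , eq = ∈-map⁻ excl i in subst (Δ′ ⊩_) (sym eq) (h v∈)))

          finish : Δ′ ⊩ D ⊎ (∀ {x} → x ∈ F → SensAt T (lab u) x) → Δ′ ⊩ D ⊎ (∀ {c} → c ∈ cs → S c u ⊎ Any (S c) (ch u)) → Δ′ ⊩ D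
          finish (inj₁ d) _ = d
          finish _ (inj₁ d) = d
          finish (inj₂ sens) (inj₂ kids) = real-excl r (hyp (e (H u∈ (All.tabulate sens , Ss-tabulate cs kids))))

  Pre : List Formula → Ctx → Formula → Set
  Pre T Δ (◇ ψ) = (◇ ψ ∈ T → ψ ∉ T → Δ ⊩ ○ (◇ ψ)) × (◇ ψ ∉ T → ψ ∉ T)
  Pre _ _ _     = ⊤

  -- Under `○` each disjunct of `next-refuted` gives `C` now: a formula through `next-elim`, the
  -- exclusion of all successors of a child through `ih`. The cuts on `○ x` settle whether an
  -- unfulfilled `◇ ψ` is postponed.
  excl-next : ∀ {T cs} → (∀ {x} → x ∈ T → Δ ⊩ x) → (∀ {x} → x ∈ F → x ∉ T → Δ ⊩ x ⇒ C) →
              (∀ {c} → c ∈ cs → Δ ⊩ excl c ⇒ C) → (∀ {c} → c ∈ cs → c ∈ M) →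
              (∀ {c} → c ∈ cs → ∀ {Γ} → (∀ {v} → v ∈ M → S c v → Γ ⊩ ○ (excl v)) → Γ ⊩ excl c) →
              (∀ {v} → v ∈ M → S (node T cs) v → Δ ⊩ ○ (excl v)) → Δ ⊩ C
  excl-next {Δ} {C} {T} {cs} pos neg child cs⊆M ih H = cuts ○ F step where
    step : ∀ {L R} Γ → _ → _ → (∀ {x} → x ∈ F → x ∈ L ⊎ x ∈ R) → Δ ⊑ Γ →
           (∀ {x} → x ∈ L → Γ ⊩ ○ x) → (∀ {x} → x ∈ R → Γ ⊩ ○ x ⇒ C) → Γ ⊩ C
    step Γ _ _ cov e l r = [ id , main ] (all-or F pre) where
      pre : ∀ {x} → x ∈ F → Γ ⊩ C ⊎ Pre T Γ x
      pre {◇ ψ} i with ◇ ψ ∈? T | ψ ∈? T | cov i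
      ... | no ¬p | yes q | _      = inj₁ (app (thm ∨i₁ ⨾ thm ◇fix ⨾ weaken e (neg i ¬p)) (weaken e (pos q)))
      ... | no ¬p | no ¬q | _      = inj₂ ((λ p → contradiction p ¬p) , λ _ → ¬q)
      ... | yes p | yes q | _      = inj₂ ((λ _ ¬q → contradiction q ¬q) , λ ¬p → contradiction p ¬p)
      ... | yes p | no ¬q | inj₁ j = inj₂ ((λ _ _ → l j) , λ ¬p → contradiction p ¬p)
      ... | yes p | no ¬q | inj₂ j = inj₁ (∨E (app (thm ◇-unfold) (weaken e (pos p))) (weaken e (neg (F-sub ◇i i) ¬q)) (r j))
      pre {⊥′}     _ = inj₂ tt
      pre {var _}  _ = inj₂ tt
      pre {_ ∧′ _} _ = inj₂ tt
      pre {_ ∨′ _} _ = inj₂ tt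
      pre {_ ⇒ _}  _ = inj₂ tt
      pre {○ _}    _ = inj₂ tt
      pre {A _}    _ = inj₂ tt

      elim : ∀ {x} → x ∈ next-refuted {T} {cs} → Γ ⊩ ○ x ⇒ C
      elim i with ∈-++⁻ (concatMap next (outside T)) i
      ... | inj₁ j = let y , y∈ , x∈ = find (∈-concatMap⁻ next {xs = outside T} j) ; y∈F , y∉ = outside-∉ {T} y∈
                     in next-elim y x∈ ⨾ weaken e (neg y∈F y∉)
      ... | inj₂ j with ∈-map⁻ _ j
      ... | c , c∈ , refl = ded (app (weaken (inj₁ ∘ e) (child c∈))
              (ih c∈ λ v∈ Scv → app (○-mono (⋀E (∈-map⁺ excl (∈-filter⁺ (S? c) v∈ Scv)))) new))

      main : (∀ {x} → x ∈ F → Pre T Γ x) → Γ ⊩ C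
      main h = app (○⋁E _ elim) (○-lift id (next-refutable
        (λ i → proj₁ (h i)) (λ i → proj₂ (h i)) (weaken e ∘ pos) cs⊆M (λ v∈ Swv → weaken e (H v∈ Swv))))

  excl-step  : ∀ w → w ∈ M → (∀ {v} → v ∈ M → S w v → Γ ⊩ ○ (excl v)) → Γ ⊩ excl w
  excl-steps : ∀ cs → (∀ {c} → c ∈ cs → c ∈ M) →
               ∀ {c} → c ∈ cs → (∀ {v} → v ∈ M → S c v → Γ ⊩ ○ (excl v)) → Γ ⊩ excl c
  excl-step (node T cs) w∈ H = excl-intro λ e pos neg child → excl-next pos neg child (ch⊆M w∈)
    (λ c∈ → excl-steps cs (ch⊆M w∈) c∈) (λ v∈ Swv → weaken e (H v∈ Swv))
  excl-steps (c ∷ _)  h (here refl) = excl-step c (h (here refl))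
  excl-steps (_ ∷ cs) h (there i)   = excl-steps cs (h ∘ there) i

  -- Derivations from a guess

  module Relative
    -- `B` is the guess as a list of hypotheses; `G` lists the formulas `A a` guessed to be true.
    (B G : List Formula)
    (B-○ : ∀ {φ} → φ ∈ B → (_∈ B) ⊩ ○ φ)
    (B-A : ∀ {φ} → A φ ∈ F → (A φ ∈ G × (_∈ B) ⊩ A φ) ⊎ (A φ ∉ G × (_∈ B) ⊩ ¬′ (A φ))) where

    infix 3 B⊩_
    B⊩_ : Formula → Set
    B⊩ φ = (_∈ B) ⊩ φ

    B-○-lift : B⊩ φ → B⊩ ○ φ
    B-○-lift = ○-lift B-○

    internalise : B⊩ φ → ⊢ ⋀ B ⇒ φ
    internalise d = closed (ded (bind (λ i → app (⋀E i) new) d))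

    -- ◇-induction has no side hypotheses, so ⋀ B is moved into the invariant.
    B-◇-ind : B⊩ ○ θ ⇒ θ → B⊩ ψ ⇒ θ → B⊩ ◇ ψ ⇒ θ
    B-◇-ind {θ} {ψ} d e = ded (app (app (thm (◇ind ind)) (app (thm (◇mono base)) new)) (⋀I B (hyp ∘ inj₁)))
      where
      base : ⊢ ψ ⇒ (⋀ B ⇒ θ)
      base = closed (ded (ded (app (app (thm (internalise e)) new) (weaken₁ new))))
      ind : ⊢ ○ (⋀ B ⇒ θ) ⇒ (⋀ B ⇒ θ)
      ind = closed (ded (ded (app (app (thm (internalise d)) new)
              (app (app (thm ○⇒) (weaken₁ new)) (app (thm (internalise (B-○-lift (⋀I B hyp)))) new)))))

    -- The invariant is the conjunction of all exclusions over `U`. It follows from `ψ`, which is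
    -- outside every label in `U`, and passes back through `○` by `excl-step`.
    excl-◇ : ∀ {U} → ψ ∈ F → (∀ {u} → u ∈ U → u ∈ M) → (∀ {u} → u ∈ U → ψ ∉ lab u) →
             (∀ {u v} → u ∈ U → v ∈ M → S u v → v ∈ U ⊎ B⊩ excl v) → ∀ {u} → u ∈ U → B⊩ ◇ ψ ⇒ excl u
    excl-◇ {ψ} {U} ψ∈ U⊆M ψ∉ next∈ i = B-◇-ind ind base ⨾ ⋀E (∈-map⁺ excl i)
      where
      all-excl : ∀ {Γ} → (∀ {u} → u ∈ U → Γ ⊩ excl u) → Γ ⊩ ⋀ (map excl U)
      all-excl {Γ} h = ⋀I _ λ j → let u , u∈ , eq = ∈-map⁻ excl j in subst (Γ ⊩_) (sym eq) (h u∈)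
      base : B⊩ ψ ⇒ ⋀ (map excl U)
      base = ded (all-excl λ u∈ → excl-pos ψ∈ (ψ∉ u∈) new)
      ind : B⊩ ○ (⋀ (map excl U)) ⇒ ⋀ (map excl U)
      ind = ded (all-excl λ {u} u∈ → excl-step u (U⊆M u∈) λ v∈ Suv →
        [ (λ v∈U → app (○-mono (⋀E (∈-map⁺ excl v∈U))) new) , (λ d → weaken₁ (B-○-lift d)) ] (next∈ u∈ v∈ Suv))

    LocalAt : List Formula → Formula → Set
    LocalAt T ⊥′       = mem ⊥′ T ≡ false
    LocalAt T (a ∧′ b) = mem (a ∧′ b) T ≡ mem a T ∧ mem b T
    LocalAt T (a ∨′ b) = mem (a ∨′ b) T ≡ mem a T ∨ mem b T
    LocalAt T (a ⇒ b)  = (a ⇒ b ∈ T → a ∈ T → b ∈ T) × (b ∈ T → a ⇒ b ∈ T)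
    LocalAt T (A a)    = mem (A a) T ≡ mem (A a) G × (A a ∈ T → a ∈ T)
    LocalAt _ _        = ⊤

    local : ∀ w {x} → x ∈ F → B⊩ excl w ⊎ LocalAt (lab w) x
    local (node T cs) {⊥′} i with ⊥′ ∈? T
    ... | yes p = inj₁ (excl-intro λ _ pos _ _ → app (thm efq) (pos p))
    ... | no _ = inj₂ refl
    local (node T cs) {a ∧′ b} i with a ∧′ b ∈? T | a ∈? T | b ∈? T
    ... | yes p | yes q | yes r = inj₂ refl
    ... | yes p | no ¬q | _ = inj₁ (excl-intro λ _ pos neg _ → app (neg (F-sub ∧l i) ¬q) (app (thm ∧e₁) (pos p)))
    ... | yes p | yes q | no ¬r = inj₁ (excl-intro λ _ pos neg _ → app (neg (F-sub ∧r i) ¬r) (app (thm ∧e₂) (pos p)))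
    ... | no ¬p | yes q | yes r = inj₁ (excl-intro λ _ pos neg _ → app (neg i ¬p) (app (app (thm ∧i) (pos q)) (pos r)))
    ... | no ¬p | no ¬q | _ = inj₂ refl
    ... | no ¬p | yes q | no ¬r = inj₂ refl
    local (node T cs) {a ∨′ b} i with a ∨′ b ∈? T | a ∈? T | b ∈? T
    ... | yes p | yes q | _ = inj₂ refl
    ... | yes p | no ¬q | yes r = inj₂ refl
    ... | yes p | no ¬q | no ¬r = inj₁ (excl-intro λ _ pos neg _ → ∨E (pos p) (neg (F-sub ∨l i) ¬q) (neg (F-sub ∨r i) ¬r))
    ... | no ¬p | yes q | _ = inj₁ (excl-intro λ _ pos neg _ → app (neg i ¬p) (app (thm ∨i₁) (pos q)))
    ... | no ¬p | no ¬q | yes r = inj₁ (excl-intro λ _ pos neg _ → app (neg i ¬p) (app (thm ∨i₂) (pos r)))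
    ... | no ¬p | no ¬q | no ¬r = inj₂ refl
    local (node T cs) {a ⇒ b} i with a ⇒ b ∈? T | a ∈? T | b ∈? T
    ... | yes p | _     | yes r = inj₂ ((λ _ _ → r) , λ _ → p)
    ... | yes p | yes q | no ¬r = inj₁ (excl-intro λ _ pos neg _ → app (neg (F-sub ⇒r i) ¬r) (app (pos p) (pos q)))
    ... | yes p | no ¬q | no ¬r = inj₂ ((λ _ q → contradiction q ¬q) , λ _ → p)
    ... | no ¬p | _     | yes r = inj₁ (excl-intro λ _ pos neg _ → app (neg i ¬p) (app (thm k) (pos r)))
    ... | no ¬p | _     | no ¬r = inj₂ ((λ p → contradiction p ¬p) , λ r → contradiction r ¬r)
    local (node T cs) {A a} i with A a ∈? T | A a ∈? G | a ∈? T | B-A i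
    ... | yes p | yes q | yes r | _ = inj₂ (refl , λ _ → r)
    ... | yes p | yes q | no ¬r | _ = inj₁ (excl-intro λ _ pos neg _ → app (neg (F-sub Ai i) ¬r) (app (thm AT) (pos p)))
    ... | yes p | no ¬q | _ | inj₁ (q , _) = contradiction q ¬q
    ... | yes p | no ¬q | _ | inj₂ (_ , d) = inj₁ (excl-intro λ e pos _ _ → app (thm efq) (app (weaken e d) (pos p)))
    ... | no ¬p | yes q | _ | inj₁ (_ , d) = inj₁ (excl-intro λ e _ neg _ → app (neg i ¬p) (weaken e d))
    ... | no ¬p | yes q | _ | inj₂ (¬q , _) = contradiction q ¬q
    ... | no ¬p | no ¬q | _ | _ = inj₂ (refl , λ p → contradiction p ¬p)
    local (node _ _) {var _} i = inj₂ tt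
    local (node _ _) {○ _} i = inj₂ tt
    local (node _ _) {◇ _} i = inj₂ tt

    -- Elimination of moments

    module Survivors (K : List Moment) where

      ReachIn : Formula → ℕ → Moment → Set
      ReachIn ψ zero    w = ψ ∈ lab w
      ReachIn ψ (suc n) w = Any (λ v → S w v × ReachIn ψ n v) K

      reachIn? : ∀ ψ n → Decidable (ReachIn ψ n)
      reachIn? ψ zero    w = ψ ∈? lab w
      reachIn? ψ (suc n) w = any? (λ v → S? w v ×-dec reachIn? ψ n v) K

      Reach : Formula → Moment → Set
      Reach ψ w = ∃ λ n → ReachIn ψ n w

      Trapped : Formula → List Moment → Set
      Trapped ψ U = (∀ {u} → u ∈ U → ψ ∉ lab u) × (∀ {u v} → u ∈ U → v ∈ K → S u v → v ∈ U)

      -- Backward search: a moment of `U` that contains `ψ` or has a successor known to reach `ψ` is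
      -- removed. When none is left, `U` is trapped; `n` bounds the removals.
      reach-or-trapped : ∀ ψ n U → length U ≤ n → (∀ {m} → m ∈ U → m ∈ K) → (∀ {m} → m ∈ K → Reach ψ m ⊎ m ∈ U) →
                         ∃ λ U → (∀ {m} → m ∈ U → m ∈ K) × (∀ {m} → m ∈ K → Reach ψ m ⊎ m ∈ U) × Trapped ψ U
      reach-or-trapped ψ n U len U⊆K cov with all-or U escape
        where
        escape : ∀ {u} → u ∈ U → (∃ λ u → u ∈ U × Reach ψ u) ⊎ (ψ ∉ lab u × (∀ {v} → v ∈ K → S u v → v ∈ U))
        escape {u} u∈ with ψ ∈? lab u
        ... | yes p = inj₁ (u , u∈ , 0 , p)
        ... | no ¬p = both (all-or K λ {v} v∈ → via v∈ (S? u v) (cov v∈))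
          where
          both : (∃ λ u → u ∈ U × Reach ψ u) ⊎ (∀ {v} → v ∈ K → S u v → v ∈ U) →
                 (∃ λ u → u ∈ U × Reach ψ u) ⊎ (ψ ∉ lab u × (∀ {v} → v ∈ K → S u v → v ∈ U))
          both (inj₁ x) = inj₁ x
          both (inj₂ h) = inj₂ (¬p , λ {v} → h {v})
          via : ∀ {v} → v ∈ K → Dec (S u v) → Reach ψ v ⊎ v ∈ U → (∃ λ u → u ∈ U × Reach ψ u) ⊎ (S u v → v ∈ U)
          via v∈ (no ¬s) _              = inj₂ λ σ → contradiction σ ¬s
          via v∈ (yes σ) (inj₂ v∈U)     = inj₂ λ _ → v∈U
          via v∈ (yes σ) (inj₁ (m , h)) = inj₁ (u , u∈ , suc m , lose v∈ (σ , h))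
      reach-or-trapped ψ zero    []       len U⊆K cov | inj₁ (_ , () , _)
      reach-or-trapped ψ (suc n) U        len U⊆K cov | inj₁ (u , u∈ , reach) with split-∈ u∈
      ... | U′ , eq , f , g = reach-or-trapped ψ n U′ (ℕₚ.≤-pred (subst (_≤ suc n) eq len)) (U⊆K ∘ g) λ m∈ →
        [ inj₁ , (λ m∈U → Sum.map₁ (λ e → subst (Reach ψ) (sym e) reach) (f m∈U)) ] (cov m∈)
      reach-or-trapped ψ n U len U⊆K cov | inj₂ h = U , U⊆K , cov , (λ u∈ → proj₁ (h u∈)) , λ u∈ → proj₂ (h u∈)

      ReachAt : Moment → Formula → Set
      ReachAt w (◇ ψ) = ◇ ψ ∈ lab w → Reach ψ w
      ReachAt _ _     = ⊤

      record GoodAt (w : Moment) : Set where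
        field
          locally  : ∀ {x} → x ∈ F → LocalAt (lab w) x
          children : ∀ {c} → c ∈ ch w → c ∈ K
          serial   : ∃ λ v → v ∈ K × S w v
          reach    : ∀ {x} → x ∈ F → ReachAt w x

      module _ (K⊆M : ∀ {m} → m ∈ K → m ∈ M) (cov : ∀ {m} → m ∈ M → m ∈ K ⊎ B⊩ excl m) where

        serial? : ∀ {w} → w ∈ M → B⊩ excl w ⊎ (∃ λ v → v ∈ K × S w v)
        serial? {w} w∈ = [ inj₂ , (λ h → inj₁ (excl-step w w∈ λ v∈ σ → h v∈ σ)) ] (all-or M λ {v} v∈ → via (S? w v) (cov v∈))
          where
          via : ∀ {v} → Dec (S w v) → v ∈ K ⊎ B⊩ excl v → (∃ λ v → v ∈ K × S w v) ⊎ (S w v → B⊩ ○ (excl v))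
          via (no ¬s) _          = inj₂ λ σ → contradiction σ ¬s
          via (yes σ) (inj₁ v∈K) = inj₁ (_ , v∈K , σ)
          via (yes σ) (inj₂ d)   = inj₂ λ _ → B-○-lift d

        reach? : ∀ {w} → w ∈ K → ∀ {x} → x ∈ F → B⊩ excl w ⊎ ReachAt w x
        reach? {w} w∈ {◇ ψ} i with ◇ ψ ∈? lab w
        ... | no ¬p = inj₂ λ p → contradiction p ¬p
        ... | yes p with reach-or-trapped ψ (length K) K ℕₚ.≤-refl id inj₂
        ... | U , U⊆K , cover , ψ∉ , stays with cover w∈
        ... | inj₁ r = inj₂ λ _ → r
        ... | inj₂ w∈U = inj₁ (discharge w p (excl-◇ (F-sub ◇i i) (K⊆M ∘ U⊆K) ψ∉
                (λ u∈ v∈ σ → Sum.map₁ (λ v∈K → stays u∈ v∈K σ) (cov v∈)) w∈U))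
          where
          -- A formula of the label may be assumed while proving the exclusion, so the premise `◇ ψ`
          -- disappears.
          discharge : ∀ w {x} → x ∈ lab w → B⊩ x ⇒ excl w → B⊩ excl w
          discharge (node T cs) p d = excl-intro λ e pos neg child → excl-elim (app (weaken e d) (pos p)) pos neg child
        reach? _ {⊥′} i = inj₂ tt
        reach? _ {var _} i = inj₂ tt
        reach? _ {_ ∧′ _} i = inj₂ tt
        reach? _ {_ ∨′ _} i = inj₂ tt
        reach? _ {_ ⇒ _} i = inj₂ tt
        reach? _ {○ _} i = inj₂ tt
        reach? _ {A _} i = inj₂ tt

        good? : ∀ {w} → w ∈ K → B⊩ excl w ⊎ GoodAt w
        good? {w} w∈ with all-or F (local w) | all-or (ch w)
                (λ c∈ → Sum.map₁ (excl-child c∈) (Sum.swap (cov (ch⊆M (K⊆M w∈) c∈))))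
                        | serial? (K⊆M w∈) | all-or F (reach? w∈)
        ... | inj₁ d | _ | _ | _ = inj₁ d
        ... | _ | inj₁ d | _ | _ = inj₁ d
        ... | _ | _ | inj₁ d | _ = inj₁ d
        ... | _ | _ | _ | inj₁ d = inj₁ d
        ... | inj₂ a | inj₂ b | inj₂ c | inj₂ d = inj₂ record { locally = a ; children = b ; serial = c ; reach = d }

    open Survivors using (GoodAt; good?) public

    eliminate : ∀ n K → length K ≤ n → (∀ {m} → m ∈ K → m ∈ M) → (∀ {m} → m ∈ M → m ∈ K ⊎ B⊩ excl m) →
                ∃ λ K → (∀ {m} → m ∈ K → m ∈ M) × (∀ {m} → m ∈ M → m ∈ K ⊎ B⊩ excl m) × (∀ {w} → w ∈ K → GoodAt K w)
    eliminate n K len K⊆M cov with all-or K (λ {w} w∈ → Sum.map₁ (λ d → w , w∈ , d) (good? K K⊆M cov w∈))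
    ... | inj₂ good = K , K⊆M , cov , good
    eliminate zero    [] len K⊆M cov | inj₁ (_ , () , _)
    eliminate (suc n) K  len K⊆M cov | inj₁ (w , w∈ , d) with split-∈ w∈
    ... | K′ , eq , f , g = eliminate n K′ (ℕₚ.≤-pred (subst (_≤ suc n) eq len)) (K⊆M ∘ g) λ m∈ →
      [ (λ m∈K → Sum.swap (Sum.map₁ (λ e → subst (λ m → B⊩ excl m) (sym e) d) (f m∈K))) , inj₂ ] (cov m∈)

    survivors : ∃ λ K → (∀ {m} → m ∈ K → m ∈ M) × (∀ {m} → m ∈ M → m ∈ K ⊎ B⊩ excl m) × (∀ {w} → w ∈ K → GoodAt K w)
    survivors = eliminate (length M) M ℕₚ.≤-refl id inj₁

    refuted-or-provable : ∀ {K} → (∀ {m} → m ∈ M → m ∈ K ⊎ B⊩ excl m) → ψ ∈ F → (∃ λ w → w ∈ K × ψ ∉ lab w) ⊎ B⊩ ψ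
    refuted-or-provable {ψ} {K} cov ψ∈ = Sum.map₂ (λ h → prove-by-excl ψ∈ λ u∈ ψ∉ → [
            (λ u∈K → contradiction (h u∈K) ψ∉) , id ] (cov u∈))
      (all-or K λ {w} w∈ → Sum.swap (decide w∈ (ψ ∈? lab w)))
      where
      decide : ∀ {w} → w ∈ K → Dec (ψ ∈ lab w) → ψ ∈ lab w ⊎ (∃ λ w → w ∈ K × ψ ∉ lab w)
      decide _  (yes p) = inj₁ p
      decide w∈ (no ¬p) = inj₂ (_ , w∈ , ¬p)

    -- The countermodel

    -- The survivors are given as a nonempty list, which supplies an initial state and a nonempty
    -- type of moves.
    module Countermodel
      (k₀ : Moment) (ks : List Moment)
      (K⊆M : ∀ {m} → m ∈ k₀ ∷ ks → m ∈ M)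
      (good : ∀ {w} → w ∈ k₀ ∷ ks → GoodAt (k₀ ∷ ks) w)
      (A-refuted : ∀ {a} → A a ∈ F → A a ∈ G ⊎ (∃ λ w → w ∈ k₀ ∷ ks × a ∉ lab w))
      where

      K : List Moment
      K = k₀ ∷ ks

      open Survivors K hiding (GoodAt)
      module Good {w} (i : w ∈ K) = Survivors.GoodAt (good i)

      I : Set
      I = Fin (length K)

      open DecMembership (Fin._≟_ {length K}) using () renaming (_∈?_ to _∈I?_)

      at : I → Moment
      at = lookup K

      at∈ : ∀ i → at i ∈ K
      at∈ = ∈-lookup {xs = K}

      index-at : ∀ {w} (p : w ∈ K) → w ≡ at (Any.index p)
      index-at p = Anyₚ.lookup-index p

      indices : ∀ cs → (∀ {c} → c ∈ cs → c ∈ K) → List I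
      indices []       h = []
      indices (c ∷ cs) h = Any.index (h (here refl)) ∷ indices cs (h ∘ there)

      indices⁻ : ∀ cs (h : ∀ {c} → c ∈ cs → c ∈ K) {j} → j ∈ indices cs h → at j ∈ cs
      indices⁻ (c ∷ cs) h (here refl) = here (sym (index-at (h (here refl))))
      indices⁻ (c ∷ cs) h (there i)   = there (indices⁻ cs (h ∘ there) i)

      indices⁺ : ∀ cs (h : ∀ {c} → c ∈ cs → c ∈ K) {P : Moment → Set} → Any P cs → Any (P ∘ at) (indices cs h)
      indices⁺ (c ∷ cs) h {P} (here p) = here (subst P (index-at (h (here refl))) p)
      indices⁺ (c ∷ cs) h     (there i) = there (indices⁺ cs (h ∘ there) i)

      kids : I → List I
      kids i = indices (ch (at i)) (Good.children (at∈ i))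

      kids⁻ : ∀ {i j} → j ∈ kids i → at j ∈ ch (at i)
      kids⁻ {i} = indices⁻ (ch (at i)) (Good.children (at∈ i))

      kids⁺ : ∀ i {P : Moment → Set} → Any P (ch (at i)) → Any (P ∘ at) (kids i)
      kids⁺ i {P} = indices⁺ (ch (at i)) (Good.children (at∈ i)) {P}

      -- The second component remembers which eventuality the default continuation is about to fulfil.
      State : Set
      State = I × Fin (suc (length F))

      labS : State → List Formula
      labS (i , _) = lab (at i)

      -- An index that names no child leaves the state alone, so one finite type of moves serves all
      -- states.
      move : I → State → State
      move j (i , t) = (if does (j ∈I? kids i) then j else i) , t

      _⟶_ : State → State → Set
      (i , _) ⟶ (j , _) = S (at i) (at j)

      -- The answer `i′` makes `i′` stay where it is, by `move-self`.
      follow : State → State → I → I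
      follow (i , _) (i′ , _) j with j ∈I? kids i | S? (at j) (at i′) | any? (λ j′ → S? (at j) (at j′)) (kids i′)
      ... | yes _ | no _ | yes p = proj₁ (find p)
      ... | _     | _    | _     = i′

      move-self : ∀ i t → move i (i , t) ≡ (i , t)
      move-self i t with does (i ∈I? kids i)
      ... | true  = refl
      ... | false = refl

      ⟶-self : ∀ {i j t u} → S (at i) (at j) → (i , t) ⟶ move j (j , u)
      ⟶-self {i} {j} {t} {u} σ = subst ((i , t) ⟶_) (sym (move-self j u)) σ

      move-kid : ∀ {i j} t → j ∈ kids i → move j (i , t) ≡ (j , t)
      move-kid {i} {j} t p = cong (λ d → (if d then j else i) , t) (dec-true (j ∈I? kids i) p)

      ⟶-move : ∀ {v w} j → v ⟶ w → move j v ⟶ move (follow v w j) w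
      ⟶-move {i , t} {i′ , u} j σ with j ∈I? kids i | S? (at j) (at i′) | any? (λ j′ → S? (at j) (at j′)) (kids i′)
      ... | no _  | _      | _     = ⟶-self {i} {i′} {t} {u} σ
      ... | yes _ | yes σ′ | _     = ⟶-self {j} {i′} {t} {u} σ′
      ... | yes _ | no _   | yes p = let j′ , j′∈ , σ′ = find p in subst ((j , t) ⟶_) (sym (move-kid u j′∈)) σ′
      ... | yes c | no ¬σ′ | no ¬p = contradiction (S-child σ (kids⁻ {i} c)) [ ¬σ′ , ¬p ∘ kids⁺ i′ ]

      -- Choice of successors and fulfilment of eventualities

      serial : ∀ i → ∃ λ j → S (at i) (at j)
      serial i = let v , v∈ , σ = Good.serial (at∈ i) in Any.index v∈ , subst (S (at i)) (index-at v∈) σ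

      lab⊆ : ∀ {i x} → x ∈ lab (at i) → x ∈ F
      lab⊆ {i} = lab⊆F (K⊆M (at∈ i))

      -- `j` is the first step of a shortest path to `ψ`, so it is closer than any given path from
      -- `i`, whatever its length `n`.
      toward : ∀ {ψ} i → ◇ ψ ∈ lab (at i) → ψ ∉ lab (at i) →
               ∃ λ j → S (at i) (at j) × (∀ {n} → ReachIn ψ n (at i) → ∃ λ m → m ℕ.< n × ReachIn ψ m (at j))
      toward {ψ} i p q with Good.reach (at∈ i) (lab⊆ {i} p) p
      ... | n , r with least (λ n → does (reachIn? ψ n (at i))) n (dec-true (reachIn? ψ n (at i)) r)
      ... | zero , e , _ = contradiction (true-mem e) q
      ... | suc m , e , _ , lo with find (does-true (reachIn? ψ (suc m) (at i)) e)
      ... | v , v∈ , σ , r′ = Any.index v∈ , subst (S (at i)) (index-at v∈) σ , λ {n} r″ → m , bound n r″ , subst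
              (ReachIn ψ m) (index-at v∈) r′
        where
        bound : ∀ n → ReachIn ψ n (at i) → m ℕ.< n
        bound n r″ = ℕₚ.≮⇒≥ λ n<sm → contradiction (trans (sym (dec-true (reachIn? ψ n (at i)) r″)) (lo n<sm)) λ ()

      -- The padding `⊥′` makes room for index zero; it is never pending.
      target : Fin (suc (length F)) → Formula
      target t = lookup (⊥′ ∷ F) t

      Pending Idle : Formula → Moment → Set
      Pending x w = ∃ λ ψ → x ≡ ◇ ψ × ◇ ψ ∈ lab w × ψ ∉ lab w
      Idle x w    = ∀ {ψ} → x ≡ ◇ ψ → ◇ ψ ∈ lab w → ψ ∈ lab w

      pending? : ∀ x w → Pending x w ⊎ Idle x w
      pending? (◇ ψ) w with ◇ ψ ∈? lab w | ψ ∈? lab w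
      ... | yes p | no q  = inj₁ (ψ , refl , p , q)
      ... | no p  | _     = inj₂ λ { refl p′ → contradiction p′ p }
      ... | _     | yes q = inj₂ λ { refl _ → q }
      pending? ⊥′       w = inj₂ λ ()
      pending? (var _)  w = inj₂ λ ()
      pending? (_ ∧′ _) w = inj₂ λ ()
      pending? (_ ∨′ _) w = inj₂ λ ()
      pending? (_ ⇒ _)  w = inj₂ λ ()
      pending? (○ _)    w = inj₂ λ ()
      pending? (A _)    w = inj₂ λ ()

      proceed : ∀ i t → Pending (target t) (at i) ⊎ Idle (target t) (at i) → State
      proceed i t (inj₁ (ψ , _ , p , q)) = proj₁ (toward i p q) , t
      proceed i t (inj₂ _)               = proj₁ (serial i) , cycle t

      default : State → State
      default (i , t) = proceed i t (pending? (target t) (at i))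

      ⟶-default : ∀ z → z ⟶ default z
      ⟶-default (i , t) with pending? (target t) (at i)
      ... | inj₁ (ψ , _ , p , q) = proj₁ (proj₂ (toward i p q))
      ... | inj₂ _               = proj₂ (serial i)

      Approaches Advances : State → Set
      Approaches (i , t) = ∃ λ j → default (i , t) ≡ (j , t) × S (at i) (at j) ×
        (∀ {χ n} → target t ≡ ◇ χ → ReachIn χ n (at i) → ∃ λ m → m ℕ.< n × ReachIn χ m (at j))
      Advances (i , t)   = Idle (target t) (at i) × default (i , t) ≡ (proj₁ (serial i) , cycle t)

      default-step : ∀ i t → Approaches (i , t) ⊎ Advances (i , t)
      default-step i t with pending? (target t) (at i)
      ... | inj₂ idle = inj₂ (idle , refl)
      ... | inj₁ (ψ , eq , p , q) = inj₁ (proj₁ (toward i p q) , refl , proj₁ (proj₂ (toward i p q)) , closer)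
        where
        closer : ∀ {χ n} → target t ≡ ◇ χ → ReachIn χ n (at i) → ∃ λ m → m ℕ.< n × ReachIn χ m (at (proj₁ (toward i p q)))
        closer eq′ r with trans (sym eq) eq′
        ... | refl = proj₂ (proj₂ (toward i p q)) r

      module _ {ψ : Formula} (ψ∈F : ◇ ψ ∈ F) where

        ◇-sens : ∀ {z z′} → z ⟶ z′ → mem (◇ ψ) (labS z) ≡ mem ψ (labS z) ∨ mem (◇ ψ) (labS z′)
        ◇-sens σ = S-sens σ ψ∈F

        ◇-forth : ∀ {z z′} → z ⟶ z′ → ◇ ψ ∈ labS z → ψ ∉ labS z → ◇ ψ ∈ labS z′
        ◇-forth {z} {z′} σ p q = true-mem (trans (cong (_∨ mem (◇ ψ) (labS z′)) (sym (mem-false q)))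
                (trans (sym (◇-sens {z} {z′} σ)) (mem-true p)))

        ◇-back : ∀ {z z′} → z ⟶ z′ → ◇ ψ ∈ labS z′ → ◇ ψ ∈ labS z
        ◇-back {z} {z′} σ p = true-mem (trans (◇-sens {z} {z′} σ)
                (trans (cong (mem ψ (labS z) ∨_) (mem-true p)) (∨-zeroʳ (mem ψ (labS z)))))

        ◇-now : ∀ {z z′} → z ⟶ z′ → ψ ∈ labS z → ◇ ψ ∈ labS z
        ◇-now {z} {z′} σ p = true-mem (trans (◇-sens {z} {z′} σ) (cong (_∨ mem (◇ ψ) (labS z′)) (mem-true p)))

        Hits : State → Set
        Hits z = ∃ λ n → ψ ∈ labS (fold z default n)

        hits-later : ∀ {z} → Hits (default z) → Hits z
        hits-later {z} (n , h) = suc n , subst (λ z → ψ ∈ labS z) (fold-shift default z n) h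

        Arrives : State → Set
        Arrives (i , t) = Hits (i , t) ⊎ (∃ λ j → ◇ ψ ∈ lab (at j) × Advances (j , t) × (Hits (j , t) → Hits (i , t)))

        -- `χ` is the eventuality being served, `ψ` the one being tracked. The distance to `χ` falls
        -- at each step, and `◇ ψ` persists until `ψ` occurs.
        run : ∀ n {m} i t {χ} → m ℕ.≤ n → target t ≡ ◇ χ → ReachIn χ m (at i) → ◇ ψ ∈ lab (at i) → Arrives (i , t)
        run n {m} i t {χ} le eq r p = go n le (ψ ∈? lab (at i)) (default-step i t)
          where
          go : ∀ n → m ℕ.≤ n → Dec (ψ ∈ lab (at i)) → Approaches (i , t) ⊎ Advances (i , t) → Arrives (i , t)
          go n le (yes q) _        = inj₁ (0 , q)
          go n le (no ¬q) (inj₂ a) = inj₂ (i , p , a , id)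
          go n le (no ¬q) (inj₁ (j , e , σ , closer)) = continue n le (closer eq r)
            where
            back : Hits (j , t) → Hits (i , t)
            back h = hits-later {i , t} (subst Hits (sym e) h)
            continue : ∀ n → m ℕ.≤ n → (∃ λ m′ → m′ ℕ.< m × ReachIn χ m′ (at j)) → Arrives (i , t)
            continue zero    le (m′ , m′<m , _)  = contradiction (ℕₚ.<-≤-trans m′<m le) λ ()
            continue (suc n) le (m′ , m′<m , r′) = Sum.map back (λ (j′ , a , b , c) → j′ , a , b , back ∘ c)
              (run n j t (ℕₚ.≤-pred (ℕₚ.≤-trans m′<m le)) eq r′ (◇-forth {i , t} {j , t} σ p ¬q))

        arrive : ∀ i t → ◇ ψ ∈ lab (at i) → Arrives (i , t)
        arrive i t p with pending? (target t) (at i) in e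
        ... | inj₂ idle = inj₂ (i , p , (idle , cong (proceed i t) e) , id)
        ... | inj₁ (χ , eq , p′ , q′) = let n , r = Good.reach (at∈ i) (lab⊆ {i} p′) p′ in run n i t ℕₚ.≤-refl eq r p

        -- Every service ends, so the target advances until it is `◇ ψ`; when that becomes idle with
        -- `◇ ψ` still in the label, `ψ` is there too.
        rounds : ∀ {t u} → Cycles t u → target u ≡ ◇ ψ → ∀ i → ◇ ψ ∈ lab (at i) → Hits (i , t)
        rounds {t} c eq i p = [ id , (λ (j , pj , a , back) → back (go c j pj a (ψ ∈? lab (at j)))) ] (arrive i t p)
          where
          go : Cycles t _ → ∀ j → ◇ ψ ∈ lab (at j) → Advances (j , t) → Dec (ψ ∈ lab (at j)) → Hits (j , t)
          go _        j pj _          (yes q) = 0 , q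
          go done     j pj (idle , _) (no ¬q) = contradiction (idle eq pj) ¬q
          go (turn c) j pj (_ , e)    (no ¬q) = hits-later {j , t} (subst Hits (sym e)
            (rounds c eq (proj₁ (serial j)) (◇-forth {j , t} {proj₁ (serial j) , t} (proj₂ (serial j)) pj ¬q)))

        default-hits : ∀ z → ◇ ψ ∈ labS z → Hits z
        default-hits (i , t) p = rounds (cycles t (suc (Any.index ψ∈F))) (sym (Anyₚ.lookup-index ψ∈F)) i p

      -- The valuation on ℚ and the truth lemma

      size : ℕ
      size = length K ℕ.* suc (length F)

      state : ℕ → State
      state n with n ℕ.<? size
      ... | yes lt = remQuot (suc (length F)) (Fin.fromℕ< lt)
      ... | no _   = zero , zero

      index : State → ℕ
      index (i , t) = toℕ (combine i t)

      index< : ∀ z → index z ℕ.< size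
      index< (i , t) = Finₚ.toℕ<n (combine i t)

      state-index : ∀ z → state (index z) ≡ z
      state-index (i , t) with index (i , t) ℕ.<? size
      ... | yes lt = trans (cong (remQuot (suc (length F))) (Finₚ.fromℕ<-toℕ (combine i t) lt)) (Finₚ.remQuot-combine i t)
      ... | no ¬lt = contradiction (index< (i , t)) ¬lt

      open Dynamics move default follow _⟶_ ⟶-default (λ {v} {w} → ⟶-move {v} {w}) state index size index< state-index
        using (f; f-continuous; limits; limits-S; limits-open; limits-onto; limits-iter; ρ-dense)

      labQ : ℚ → List Formula
      labQ x = labS (limits x)

      V : ℕ → Pred
      V p x = var p ∈ labQ x

      bigger : ∀ {i j x} → j ∈ kids i → x ∈ lab (at i) → x ∈ lab (at j)
      bigger {i} j∈ = All.lookup (proj₁ (All.lookup (proj₁ (Ok.legit (M⁻ (K⊆M (at∈ i))))) (kids⁻ {i} j∈)))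

      move-grows : ∀ {x z} j → x ∈ labS z → x ∈ labS (move j z)
      move-grows {x} {i , t} j p with j ∈I? kids i
      ... | yes j∈ = bigger {i} j∈ p
      ... | no _   = p

      labQ-open : ∀ {φ} x → φ ∈ labQ x → Nearby x (λ y → φ ∈ labQ y)
      labQ-open {φ} = limits-open {λ z → φ ∈ labS z} (λ {z} → move-grows {φ} {z})

      locally : ∀ {φ} x → φ ∈ F → LocalAt (labQ x) φ
      locally x i = Good.locally (at∈ (proj₁ (limits x))) i

      witnessed : ∀ x {a b} → a ⇒ b ∈ F → Witnessed (labQ x) (ch (at (proj₁ (limits x)))) (a ⇒ b)
      witnessed x i = All.lookup (proj₂ (Ok.legit (M⁻ (K⊆M (at∈ (proj₁ (limits x))))))) i

      true-∨ : ∀ {a b} → a ∨ b ≡ true → a ≡ true ⊎ b ≡ true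
      true-∨ {true}  _ = inj₁ refl
      true-∨ {false} e = inj₂ e

      ◇-iter-forth : ∀ {ψ} → ◇ ψ ∈ F → ∀ x n → ◇ ψ ∈ labQ x → (∃ λ m → ψ ∈ labQ (iter f m x)) ⊎ ◇ ψ ∈ labQ (iter f n x)
      ◇-iter-forth i x zero    p = inj₂ p
      ◇-iter-forth {ψ} i x (suc n) p with ◇-iter-forth i x n p
      ... | inj₁ h = inj₁ h
      ... | inj₂ q with ψ ∈? labQ (iter f n x)
      ... | yes h = inj₁ (n , h)
      ... | no ¬h = inj₂ (◇-forth i {limits (iter f n x)} {limits (iter f (suc n) x)} (limits-S (iter f n x)) q ¬h)

      ◇-iter-back : ∀ {ψ} → ◇ ψ ∈ F → ∀ x n → ◇ ψ ∈ labQ (iter f n x) → ◇ ψ ∈ labQ x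
      ◇-iter-back i x zero    p = p
      ◇-iter-back i x (suc n) p = ◇-iter-back i x n (◇-back i {limits (iter f n x)} {limits (iter f (suc n) x)}
              (limits-S (iter f n x)) p)

      -- Until the orbit settles, `ψ` occurs or `◇ ψ` survives; from then on `default-hits` applies.
      ◇-fulfilled : ∀ {ψ} → ◇ ψ ∈ F → ∀ x → ◇ ψ ∈ labQ x → ∃ λ m → ψ ∈ labQ (iter f m x)
      ◇-fulfilled {ψ} i x p = let n , v , e = limits-iter x in
        [ id , (λ q → let m , h = default-hits i v (subst (λ z → ◇ ψ ∈ labS z) (e 0) q)
                      in m ℕ.+ n , subst (λ z → ψ ∈ labS z) (sym (e m)) h) ] (◇-iter-forth i x n p)

      realised : ∀ {w} → w ∈ K → ∃ λ y → labQ y ≡ lab w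
      realised w∈ = let y , e = limits-onto (Any.index w∈ , zero) in y , trans (cong labS e) (cong lab (sym (index-at w∈)))

      sound    : ∀ ψ → ψ ∈ F → ∀ x → ψ ∈ labQ x → ⟦ ψ ⟧ f V x
      complete : ∀ ψ → ψ ∈ F → ∀ x → ⟦ ψ ⟧ f V x → ψ ∈ labQ x

      sound ⊥′       i x p = contradiction (trans (sym (mem-true p)) (locally x i)) λ ()
      sound (var _)  i x p = p
      sound (a ∧′ b) i x p = let q , r = ∧-split {mem a (labQ x)} (trans (sym (locally x i)) (mem-true p)) in
        sound a (F-sub ∧l i) x (true-mem q) , sound b (F-sub ∧r i) x (true-mem r)
      sound (a ∨′ b) i x p = Sum.map (λ q → sound a (F-sub ∨l i) x (true-mem q)) (λ q → sound b (F-sub ∨r i) x (true-mem q))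
        (true-∨ {mem a (labQ x)} (trans (sym (locally x i)) (mem-true p)))
      sound (a ⇒ b)  i x p = Nearby-map (λ {y} q h → sound b (F-sub ⇒r i) y
              (proj₁ (locally y i) q (complete a (F-sub ⇒l i) y h))) (labQ-open x p)
      sound (○ a)    i x p = sound a (F-sub ○i i) (f x) (true-mem (trans (sym (S-sens (limits-S x) i)) (mem-true p)))
      sound (◇ a)    i x p = let n , q = ◇-fulfilled i x p in n , sound a (F-sub ◇i i) (iter f n x) q
      sound (A a)    i x p y = sound a (F-sub Ai i) y (proj₂ (locally y i) (true-mem
        (trans (proj₁ (locally y i)) (trans (sym (proj₁ (locally x i))) (mem-true p)))))

      complete (var _)  i x h = h
      complete (a ∧′ b) i x (h , h′) = true-mem (trans (locally x i)
        (cong₂ _∧_ (mem-true (complete a (F-sub ∧l i) x h)) (mem-true (complete b (F-sub ∧r i) x h′))))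
      complete (a ∨′ b) i x (inj₁ h) = true-mem (trans (locally x i)
              (cong (_∨ mem b (labQ x)) (mem-true (complete a (F-sub ∨l i) x h))))
      complete (a ∨′ b) i x (inj₂ h) = true-mem (trans (locally x i)
        (trans (cong (mem a (labQ x) ∨_) (mem-true (complete b (F-sub ∨r i) x h))) (∨-zeroʳ (mem a (labQ x)))))
      complete (a ⇒ b)  i x (ε , 0<ε , h) = go (witnessed x i)
        where
        pointwise : ∀ y → ∣ y - x ∣ ℚ.< ε → a ∈ labQ y → b ∈ labQ y
        pointwise y lt q = complete b (F-sub ⇒r i) y (h y lt (sound a (F-sub ⇒l i) y q))
        -- The child `j` is the limit of some point within `ε` of `x`, where the implication holds
        -- pointwise.
        at-kid : ∀ {j} → j ∈ kids (proj₁ (limits x)) → a ∈ lab (at j) → b ∈ lab (at j)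
        at-kid {j} j∈ q = let y , lt , e = ρ-dense x j 0<ε
                              lab≡ = cong labS (trans e (move-kid (proj₂ (limits x)) j∈))
                          in subst (b ∈_) lab≡ (pointwise y lt (subst (a ∈_) (sym lab≡) q))
        go : Witnessed (labQ x) (ch (at (proj₁ (limits x)))) (a ⇒ b) → a ⇒ b ∈ labQ x
        go (inj₁ p)        = p
        go (inj₂ (inj₁ q)) = proj₂ (locally x i) (pointwise x (∣x-x∣<ε x 0<ε) q)
        go (inj₂ (inj₂ c)) = let j , j∈ , q , ¬r = find (kids⁺ (proj₁ (limits x)) c) in contradiction (at-kid j∈ q) ¬r
      complete (○ a)    i x h = true-mem (trans (S-sens (limits-S x) i) (mem-true (complete a (F-sub ○i i) (f x) h)))
      complete (◇ a)    i x (n , h) = ◇-iter-back i x n (◇-now i {limits (iter f n x)} {limits (iter f (suc n) x)}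
              (limits-S (iter f n x))
        (complete a (F-sub ◇i i) (iter f n x) h))
      complete (A a)    i x h = go (A-refuted i)
        where
        go : A a ∈ G ⊎ (∃ λ w → w ∈ K × a ∉ lab w) → A a ∈ labQ x
        go (inj₁ g) = true-mem (trans (proj₁ (locally x i)) (mem-true g))
        go (inj₂ (w , w∈ , a∉)) = let y , e = realised w∈ in contradiction (subst (a ∈_) e (complete a (F-sub Ai i) y (h y))) a∉

      not-valid : ∀ {φ w} → φ ∈ F → w ∈ K → φ ∉ lab w → ¬ ValidOnℚ φ
      not-valid {φ} i w∈ φ∉ valid = let y , e = realised w∈ in
        contradiction (subst (φ ∈_) e (complete φ i y (valid f f-continuous V (λ p x → labQ-open x) y))) φ∉

-- Subformulas

subs : Formula → List Formula
subs ⊥′       = ⊥′ ∷ []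
subs (var p)  = var p ∷ []
subs (φ ∧′ ψ) = φ ∧′ ψ ∷ subs φ ++ subs ψ
subs (φ ∨′ ψ) = φ ∨′ ψ ∷ subs φ ++ subs ψ
subs (φ ⇒ ψ)  = (φ ⇒ ψ) ∷ subs φ ++ subs ψ
subs (○ φ)    = ○ φ ∷ subs φ
subs (◇ φ)    = ◇ φ ∷ subs φ
subs (A φ)    = A φ ∷ subs φ

subs-self : ∀ φ → φ ∈ subs φ
subs-self ⊥′       = here refl
subs-self (var _)  = here refl
subs-self (_ ∧′ _) = here refl
subs-self (_ ∨′ _) = here refl
subs-self (_ ⇒ _)  = here refl
subs-self (○ _)    = here refl
subs-self (◇ _)    = here refl
subs-self (A _)    = here refl

subs-imm  : ∀ χ → Imm φ ψ → ψ ∈ subs χ → φ ∈ subs χ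
subs-imm₂ : ∀ χ θ → Imm φ ψ → ψ ∈ subs χ ++ subs θ → φ ∈ subs χ ++ subs θ
subs-imm₂ χ θ m i with ∈-++⁻ (subs χ) i
... | inj₁ j = ∈-++⁺ˡ (subs-imm χ m j)
... | inj₂ j = ∈-++⁺ʳ (subs χ) (subs-imm θ m j)
subs-imm ⊥′       () (here refl)
subs-imm (var _)  () (here refl)
subs-imm (χ ∧′ θ) ∧l (here refl) = there (∈-++⁺ˡ (subs-self χ))
subs-imm (χ ∧′ θ) ∧r (here refl) = there (∈-++⁺ʳ (subs χ) (subs-self θ))
subs-imm (χ ∨′ θ) ∨l (here refl) = there (∈-++⁺ˡ (subs-self χ))
subs-imm (χ ∨′ θ) ∨r (here refl) = there (∈-++⁺ʳ (subs χ) (subs-self θ))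
subs-imm (χ ⇒ θ)  ⇒l (here refl) = there (∈-++⁺ˡ (subs-self χ))
subs-imm (χ ⇒ θ)  ⇒r (here refl) = there (∈-++⁺ʳ (subs χ) (subs-self θ))
subs-imm (○ χ)    ○i (here refl) = there (subs-self χ)
subs-imm (◇ χ)    ◇i (here refl) = there (subs-self χ)
subs-imm (A χ)    Ai (here refl) = there (subs-self χ)
subs-imm (χ ∧′ θ) m  (there i) = there (subs-imm₂ χ θ m i)
subs-imm (χ ∨′ θ) m  (there i) = there (subs-imm₂ χ θ m i)
subs-imm (χ ⇒ θ)  m  (there i) = there (subs-imm₂ χ θ m i)
subs-imm (○ χ)    m  (there i) = there (subs-imm χ m i)
subs-imm (◇ χ)    m  (there i) = there (subs-imm χ m i)
subs-imm (A χ)    m  (there i) = there (subs-imm χ m i)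

-- Guessing the universal formulas

base : List Formula → List Formula → List Formula
base L R = map A L ++ map (¬′ ∘ A) R

base-no : ∀ {L R} → φ ∈ R → ¬′ (A φ) ∈ base L R
base-no {L = L} i = ∈-++⁺ʳ (map A L) (∈-map⁺ (¬′ ∘ A) i)

base-elim : ∀ {L R} {P : Formula → Set} → (∀ φ → P (A φ)) → (∀ φ → P (¬′ (A φ))) → ∀ {x} → x ∈ base L R → P x
base-elim {L} {R} p n i with ∈-++⁻ (map A L) i
... | inj₁ j with ∈-map⁻ A j
... | a , _ , refl = p a
base-elim {L} {R} p n i | inj₂ j with ∈-map⁻ (¬′ ∘ A) {xs = R} j
... | a , _ , refl = n a

A⇒○A : Γ ⊩ A φ ⇒ ○ (A φ)
A⇒○A = app (thm ∧e₁) (thm A○)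

-- Apply `○nec` to `Aem` and distribute; the case `○ (A φ)` falls back to `A φ` by `A○`.
¬A⇒○¬A : Γ ⊩ ¬′ (A φ) ⇒ ○ (¬′ (A φ))
¬A⇒○¬A = ded (∨E (app (thm ○∨) (thm (○nec Aem))) (app (thm ∧e₂) (thm A○) ⨾ new ⨾ thm efq) (ded new))

-- Negative introspection as in S5: necessitate `Aem` with its disjuncts swapped and apply `A∨`.
¬A⇒A¬A : Γ ⊩ ¬′ (A φ) ⇒ A (¬′ (A φ))
¬A⇒A¬A = ded (∨E (app (thm A∨) (thm (Anec (closed (∨E (thm Aem) (thm ∨i₂) (thm ∨i₁)))))) (ded new) (new ⨾ thm efq))

-- By `Aem` the guess is a case distinction inside the logic, so it suffices to derive `C` from each
-- complete guess.
decide-A : ∀ xs L R → (∀ L′ R′ → (∀ {a} → a ∈ L → a ∈ L′) → (∀ {a} → a ∈ R → a ∈ R′) → (∀ {a} → a ∈ xs → a ∈ L′ ⊎ a ∈ R′) →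
           (_∈ base L′ R′) ⊩ C) → (_∈ base L R) ⊩ C
decide-A [] L R H = H L R id id λ ()
decide-A {C} (x ∷ xs) L R H = ∨E (thm Aem) (ded (bind yes-base left)) (ded (bind no-base right))
  where
  left : (_∈ base (x ∷ L) R) ⊩ C
  left = decide-A xs (x ∷ L) R λ L′ R′ l r c → H L′ R′ (l ∘ there) r λ { (here refl) → inj₁ (l (here refl)) ; (there i) → c i }
  right : (_∈ base L (x ∷ R)) ⊩ C
  right = decide-A xs L (x ∷ R) λ L′ R′ l r c → H L′ R′ l (r ∘ there) λ { (here refl) → inj₂ (r (here refl)) ; (there i) → c i }
  yes-base : ∀ {χ} → χ ∈ base (x ∷ L) R → (_∈ base L R) ▸ A x ⊩ χ
  yes-base (here refl) = new
  yes-base (there i)   = hyp (inj₁ i)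
  no-base : ∀ {χ} → χ ∈ base L (x ∷ R) → (_∈ base L R) ▸ ¬′ (A x) ⊩ χ
  no-base i with ∈-++⁻ (map A L) i
  ... | inj₁ j           = hyp (inj₁ (∈-++⁺ˡ j))
  ... | inj₂ (here refl) = new
  ... | inj₂ (there j)   = hyp (inj₁ (∈-++⁺ʳ (map A L) j))

-- Completeness under one guess of the universal formulas

module Completeness (φ : Formula) (valid : ValidOnℚ φ) (L R : List Formula) (cover : ∀ {a} → a ∈ subs φ → a ∈ L ⊎ a ∈ R) where

  F = subs φ
  F-sub : ∀ {χ ψ} → Imm χ ψ → ψ ∈ F → χ ∈ F
  F-sub = subs-imm φ

  B = base L R

  B-○ : ψ ∈ B → (_∈ B) ⊩ ○ ψ
  B-○ i = app (base-elim {L} {R} {λ x → (_∈ B) ⊩ x ⇒ ○ x} (λ _ → A⇒○A) (λ _ → ¬A⇒○¬A) i) (hyp i)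

  B-nec : (_∈ B) ⊩ ψ → (_∈ B) ⊩ A ψ
  B-nec = A-lift λ i → app (base-elim {L} {R} {λ x → (_∈ B) ⊩ x ⇒ A x} (λ _ → thm A4) (λ _ → ¬A⇒A¬A) i) (hyp i)

  B-A : A ψ ∈ F → (A ψ ∈ map A L × (_∈ B) ⊩ A ψ) ⊎ (A ψ ∉ map A L × (_∈ B) ⊩ ¬′ (A ψ))
  B-A {ψ} i with A ψ ∈? map A L
  ... | yes p = inj₁ (p , hyp (∈-++⁺ˡ p))
  ... | no ¬p with cover (F-sub Ai i)
  ... | inj₁ l = contradiction (∈-map⁺ A l) ¬p
  ... | inj₂ r = inj₂ (¬p , hyp (base-no {L = L} r))

  open Moments F F-sub using (M; excl; module Relative)
  open Relative B (map A L) B-○ B-A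

  -- A guess that denies `A a` needs a survivor omitting `a`. If there is none, `a` follows from
  -- `B`, hence so does `A a` by `B-nec`, and the inconsistent `B` proves `φ`.
  A-resolved : ∀ {K} → (∀ {m} → m ∈ M → m ∈ K ⊎ B⊩ excl m) → ∀ a → A a ∈ F → B⊩ φ ⊎
          (A a ∈ map A L ⊎ (∃ λ w → w ∈ K × a ∉ lab w))
  A-resolved cov a i with B-A i | refuted-or-provable cov (F-sub Ai i)
  ... | inj₁ (p , _)  | _      = inj₂ (inj₁ p)
  ... | _             | inj₁ h = inj₂ (inj₂ h)
  ... | inj₂ (_ , ¬A) | inj₂ d = inj₁ (app (thm efq) (app ¬A (B-nec d)))

  A-resolved? : ∀ {K} → (∀ {m} → m ∈ M → m ∈ K ⊎ B⊩ excl m) → B⊩ φ ⊎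
          (∀ {a} → A a ∈ F → A a ∈ map A L ⊎ (∃ λ w → w ∈ K × a ∉ lab w))
  A-resolved? {K} cov = Sum.map₂ (λ h i → h (F-sub Ai i) i)
    (all-or {P = λ a → A a ∈ F → A a ∈ map A L ⊎ (∃ λ w → w ∈ K × a ∉ lab w)} F (λ {a} _ → by-cases a))
    where
    by-cases : ∀ a → B⊩ φ ⊎ (A a ∈ F → A a ∈ map A L ⊎ (∃ λ w → w ∈ K × a ∉ lab w))
    by-cases a with A a ∈? F
    ... | no ¬i = inj₂ λ i → contradiction i ¬i
    ... | yes i = Sum.map₂ (λ h _ → h) (A-resolved cov a i)

  provable : B⊩ φ
  provable with survivors
  ... | K , K⊆M , cov , good with A-resolved? cov | refuted-or-provable cov (subs-self φ)
  ... | inj₁ d | _      = d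
  ... | _      | inj₂ d = d
  ... | inj₂ A-refuted | inj₁ (w , w∈ , φ∉) = contradiction valid (refute K K⊆M good A-refuted w∈)
    where
    refute : ∀ K → (∀ {m} → m ∈ K → m ∈ M) → (∀ {w} → w ∈ K → GoodAt K w) →
             (∀ {a} → A a ∈ F → A a ∈ map A L ⊎ (∃ λ w → w ∈ K × a ∉ lab w)) → w ∈ K → ¬ ValidOnℚ φ
    refute (k₀ ∷ ks) K⊆M good A-refuted w∈ = Countermodel.not-valid k₀ ks K⊆M good A-refuted (subs-self φ) w∈ φ∉

theorem11p8 : (φ : Formula) → ValidOnℚ φ → ⊢ φ
theorem11p8 φ valid = closed (weaken (λ ()) (decide-A (subs φ) [] [] λ L R _ _ cover → Completeness.provable φ valid L R cover))
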